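{- Let $f,\varphi,\psi\in\mathcal{F}^{\ast}$ and $a,b\in\mathcal{F}_1\cup\mathcal{F}^{\ast}$. Then there are uniquely determined sequences of constants $(c_n)_{n\ge0}$ and $(d_n)_{n\ge0}$ in $\mathbb{K}$ such that $f(x)=\sum_{n\ge0}\frac{c_n}{n!}a(x)\varphi(x)^n$ and $\bar f(x)=\sum_{n\ge0}\frac{d_n}{n!}b(x)\psi(x)^n$, where $\bar f$ is the compositional inverse of $f$. Moreover $d_n=\Lambda_n(a,\varphi\,|\,b,\psi)(c_0,c_1,\ldots)$ and $c_n=\Lambda_n(b,\psi\,|\,a,\varphi)(d_0,d_1,\ldots)$, or equivalently $\Lambda_n(a,\varphi\,|\,b,\psi)\circ\Lambda_{\bullet}(b,\psi\,|\,a,\varphi)=X_n$ for every $n\ge1$.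
   Context: $\mathbb{K}$ is a field of characteristic zero, $\mathcal{F}=\mathbb{K}[[x]]$ with derivation $D$; $\mathcal{F}_1$ is the set of series with nonzero constant term, $\mathcal{F}^{\ast}$ the set of series $g$ with $g(0)=0$, $D(g)(0)\ne0$. Partial Bell polynomials: $B_{0,0}=1$, $B_{n,0}=0$ ($n\ge1$), $B_{n,k}=0$ ($k>n$), and for $1\le k\le n$, $B_{n,k}=\sum\frac{n!}{\prod_i r_i!(i!)^{r_i}}\prod_i X_i^{r_i}$ over non-negative integers $r_i$ with $\sum r_i=k$, $\sum ir_i=n$. $A_{n,k}$ is the unique lower triangular family with $A_{0,0}=1$, $A_{n,0}=0$ ($n\ge1$) and $\sum_{j=k}^nA_{n,j}B_{j,k}=\delta_{nk}$ ($0\le k\le n$); they lie in $\mathbb{K}[X_1^{ -1},X_1,X_2,\ldots]$. For a polynomial $P$ and a function $\varphi$, $P^{\varphi}(0)$ means $P$ with each $X_j$ replaced by $D^j(\varphi)(0)$. The reciprocal polynomials are $\widehat R_n:=\sum_{k=0}^n(-1)^kk!\,X_0^{ -(k+1)}B_{n,k}$. For $a\in\mathcal{F}$ write $a_j=D^j(a)(0)$. For $\varphi\in\mathcal{F}_0$ define $\Gamma_n(a,\varphi):=\sum_{k=0}^n\big(\sum_{j=k}^n\binom{n}{j}a_{n-j}B^{\varphi}_{j,k}(0)\big)X_k$. If $a\in\mathcal{F}_1$ put $\Gamma^{(1)}_n(a,\varphi):=\Gamma_n(a,\varphi)(0,X_1,\ldots,X_n)$ (i.e. $X_0:=0$) and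 $\bar\Gamma^{(1)}_n(a,\varphi):=\sum_{k=0}^n\big(\sum_{j=k}^n\binom jk\widehat R_{j-k}(a_0,\ldots,a_{j-k})A^{\varphi}_{n,j}(0)\big)X_k$; if $a\in\mathcal{F}^{\ast}$ put $\Gamma^{(2)}_n(a,\varphi):=\Gamma_n(a,\varphi)$ and $\bar\Gamma^{(2)}_n(a,\varphi):=\sum_{k=0}^n\frac1{k+1}\big(\sum_{j=k}^n\binom jk\widehat R_{j-k}(\tfrac{a_1}{1},\ldots,\tfrac{a_{j-k+1}}{j-k+1})A^{\varphi}_{n,j}(0)\big)X_{k+1}$. $\Gamma_n$ and $\bar\Gamma_n$ denote the version $(1)$ or $(2)$ according as the first argument lies in $\mathcal{F}_1$ or $\mathcal{F}^{\ast}$. Then $\Lambda_n(a,\varphi\,|\,b,\psi):=\bar\Gamma_n(b,\psi)\circ A_{\bullet,1}\circ\Gamma_{\bullet}(a,\varphi)$, meaning: in $\bar\Gamma_n(b,\psi)$ each $X_j$ is replaced by $A_{j,1}(\Gamma_1(a,\varphi),\ldots,\Gamma_j(a,\varphi))$ (with $A_{0,1}=0$). In general, $P\circ Q_{\bullet}$ denotes replacing each $X_j$ in $P$ by $Q_j$, and $P(c_0,c_1,\ldots)$ denotes evaluation at $X_j=c_j$. -}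

module Defs where

open import Level using (Level; _⊔_) renaming (suc to lsuc)
open import Data.Nat as ℕ using (ℕ; zero; suc; _∸_; _≤_; _<_; _≤ᵇ_; _≡ᵇ_; _!)
open import Data.Nat.Combinatorics using (_C_)
open import Data.Bool using (Bool; true; false; if_then_else_; _∧_)
open import Data.List as List using (List; []; _∷_)
open import Data.Vec as Vec using (Vec; []; _∷_)
open import Data.Product using (_×_; _,_; proj₁; proj₂; Σ-syntax)
open import Relation.Nullary using (¬_)
open import Algebra.Bundles using (CommutativeRing)

module NatEmbed {c ℓ} (R : CommutativeRing c ℓ) where
  open CommutativeRing R
  natK : ℕ → Carrier
  natK zero    = 0#
  natK (suc n) = 1# + natK n

-- A field of characteristic zero.  The inverse is a total function
-- (value at 0 unconstrained), required to be a genuine inverse on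
-- nonzero elements.

record CharZeroField (c ℓ : Level) : Set (lsuc (c ⊔ ℓ)) where
  field
    commutativeRing : CommutativeRing c ℓ
  open CommutativeRing commutativeRing public
  open NatEmbed commutativeRing public
  field
    _⁻¹        : Carrier → Carrier
    ⁻¹-inverse : ∀ x → ¬ (x ≈ 0#) → x * (x ⁻¹) ≈ 1#
    charZero   : ∀ n → ¬ (natK (suc n) ≈ 0#)

module FPS {c ℓ} (F : CharZeroField c ℓ) where
  open CharZeroField F

  _^_ : Carrier → ℕ → Carrier
  x ^ zero  = 1#
  x ^ suc n = x * (x ^ n)

  sum< : ℕ → (ℕ → Carrier) → Carrier
  sum< zero    f = 0#
  sum< (suc n) f = sum< n f + f n

  sumFromTo : ℕ → ℕ → (ℕ → Carrier) → Carrier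
  sumFromTo k n f = sum< (suc n) (λ j → if k ≤ᵇ j then f j else 0#)

  -- Partial Bell polynomials, evaluated at x (only x 1, x 2, … used),
  -- as the sum over (r_1,…,r_n) with Σ r_i = k, Σ i r_i = n of
  -- n! / Π (r_i! (i!)^{r_i}) · Π x_i^{r_i}.
  -- (Any r_i with i > n is forced to be 0; each r_i ≤ n.)

  allVecs : (len bound : ℕ) → List (Vec ℕ len)
  allVecs zero    b = Vec.[] ∷ []
  allVecs (suc l) b =
    List.concatMap (λ v → List.map (λ r → r Vec.∷ v) (List.upTo (suc b))) (allVecs l b)

  indexed : ∀ {m} → ℕ → Vec ℕ m → List (ℕ × ℕ)
  indexed s Vec.[]       = []
  indexed s (r Vec.∷ v)  = (s , r) ∷ indexed (suc s) v

  sumℕ : List ℕ → ℕ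
  sumℕ = List.foldr ℕ._+_ 0

  prodℕ : List ℕ → ℕ
  prodℕ = List.foldr ℕ._*_ 1

  prodK : List Carrier → Carrier
  prodK = List.foldr _*_ 1#

  sumK : List Carrier → Carrier
  sumK = List.foldr _+_ 0#

  bellTerm : (n k : ℕ) → (ℕ → Carrier) → Vec ℕ n → Carrier
  bellTerm n k x r =
    if (sumℕ (List.map proj₂ ir) ≡ᵇ k) ∧ (sumℕ (List.map (λ p → proj₁ p ℕ.* proj₂ p) ir) ≡ᵇ n)
    then natK (n !)
         * ((natK (prodℕ (List.map (λ p → (proj₂ p !) ℕ.* ((proj₁ p !) ℕ.^ proj₂ p)) ir))) ⁻¹)
         * prodK (List.map (λ p → x (proj₁ p) ^ proj₂ p) ir)
    else 0#
    where ir = indexed 1 r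

  Bell : (n k : ℕ) → (ℕ → Carrier) → Carrier
  Bell n k x = sumK (List.map (bellTerm n k x) (allVecs n n))

  -- The family A_{n,k}: given as evaluation functions, characterised
  -- (at every point x with x 1 ≠ 0, where these Laurent polynomials are
  -- defined) by the defining system of the paper.

  δ : ℕ → ℕ → Carrier
  δ n k = if n ≡ᵇ k then 1# else 0#

  IsAFamily : (ℕ → ℕ → (ℕ → Carrier) → Carrier) → Set (c ⊔ ℓ)
  IsAFamily A = ∀ (x : ℕ → Carrier) → ¬ (x 1 ≈ 0#) →
      (A 0 0 x ≈ 1#)
    × (∀ n → A (suc n) 0 x ≈ 0#)
    × (∀ n j → n < j → A n j x ≈ 0#)
    × (∀ n k → k ≤ n → sumFromTo k n (λ j → A n j x * Bell j k x) ≈ δ n k)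

  Rhat : ℕ → (ℕ → Carrier) → Carrier
  Rhat n z = sum< (suc n) (λ k →
    ((- 1#) ^ k) * natK (k !) * ((z 0 ^ suc k) ⁻¹) * Bell n k z)

  Series : Set c
  Series = ℕ → Carrier

  -- D^j(s)(0) = j! · (j-th coefficient)
  der : ℕ → Series → Carrier
  der j s = natK (j !) * s j

  oneS : Series
  oneS zero    = 1#
  oneS (suc _) = 0#

  Xs : Series
  Xs m = if m ≡ᵇ 1 then 1# else 0#

  _⋆_ : Series → Series → Series
  (s ⋆ t) n = sum< (suc n) (λ i → s i * t (n ∸ i))

  _^S_ : Series → ℕ → Series
  s ^S zero  = oneS
  s ^S suc n = s ⋆ (s ^S n)

  -- composition f ∘ g (meaningful when g 0 = 0)
  _∘S_ : Series → Series → Series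
  (f ∘S g) m = sum< (suc m) (λ k → f k * (g ^S k) m)

  IsCompInverse : Series → Series → Set ℓ
  IsCompInverse f g = (g 0 ≈ 0#) × (∀ m → (f ∘S g) m ≈ Xs m) × (∀ m → (g ∘S f) m ≈ Xs m)

  F₁ : Series → Set ℓ
  F₁ s = ¬ (s 0 ≈ 0#)

  F* : Series → Set ℓ
  F* s = (s 0 ≈ 0#) × ¬ (der 1 s ≈ 0#)

  data Kind : Set where
    one star : Kind

  InKind : Kind → Series → Set ℓ
  InKind one  s = F₁ s
  InKind star s = F* s

  -- f(x) = Σ_{n≥0} c_n/n! · a(x) φ(x)^n  (coefficientwise; φ ∈ 𝓕* so
  -- only n ≤ m contribute to the m-th coefficient)
  Expands : Series → Series → Series → (ℕ → Carrier) → Set ℓ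
  Expands f a φ cs = ∀ m →
    f m ≈ sum< (suc m) (λ n → cs n * ((natK (n !)) ⁻¹) * (a ⋆ (φ ^S n)) m)

  Γ : Kind → Series → Series → ℕ → (ℕ → Carrier) → Carrier
  Γ ka a φ n y = sum< (suc n) (λ k → coeff k * y′ ka k)
    where
    coeff : ℕ → Carrier
    coeff k = sumFromTo k n (λ j →
      natK (n C j) * der (n ∸ j) a * Bell j k (λ i → der i φ))
    y′ : Kind → ℕ → Carrier
    y′ one  zero    = 0#
    y′ one  (suc k) = y (suc k)
    y′ star k       = y k

  Γbar : (ℕ → ℕ → (ℕ → Carrier) → Carrier) →
         Kind → Series → Series → ℕ → (ℕ → Carrier) → Carrier
  Γbar A one b ψ n y = sum< (suc n) (λ k →
    sumFromTo k n (λ j →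
      natK (j C k) * Rhat (j ∸ k) (λ i → der i b) * A n j (λ i → der i ψ))
    * y k)
  Γbar A star b ψ n y = sum< (suc n) (λ k →
    (natK (suc k) ⁻¹) *
    sumFromTo k n (λ j →
      natK (j C k)
      * Rhat (j ∸ k) (λ i → (natK (suc i) ⁻¹) * der (suc i) b)
      * A n j (λ i → der i ψ))
    * y (suc k))

  Λ : (ℕ → ℕ → (ℕ → Carrier) → Carrier) →
      Kind → Series → Series → Kind → Series → Series →
      ℕ → (ℕ → Carrier) → Carrier
  Λ A ka a φ kb b ψ n cs =
    Γbar A kb b ψ n (λ j → A j 1 (λ i → Γ ka a φ i cs))

{-# OPTIONS --safe #-}
module Submission where

-- The Bell matrix of a series u with u(0) = 0 is B_{n,k} = (n!/k!) [xⁿ] uᵏ, by the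
-- multinomial theorem.  Hence f = Σ cₙ/n! · a φⁿ says that the derivatives at 0 of
-- f/a form the vector B^φ c, so c is A^φ applied to them; this gives uniqueness,
-- and existence follows because a lower triangular matrix with invertible diagonal
-- is injective.  Applying A^f to the first unit vector gives the derivatives of the
-- inverse series of f, since f̄ ∘ f = x.  As Γ(a,φ) sends c to the derivatives of f,
-- and Γ̄(b,ψ) sends those of f̄ to A^ψ applied to those of f̄/b (R̂ being the
-- derivatives of a reciprocal series), Λ sends c to d.

open import Defs
open import Level using (Level)
open import Algebra.Bundles using (CommutativeSemiring)
open import Data.Bool using (true; false; if_then_else_; _∧_; T)
open import Data.Empty using (⊥-elim)
open import Data.Fin using (toℕ)
open import Data.List as List using (List; []; _∷_)
import Data.List.Properties as Listₚ
open import Data.Nat as ℕ using (ℕ; zero; suc; _∸_; _≤_; _<_; _≤ᵇ_; _≡ᵇ_; _!; z≤n; s≤s; NonZero)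
open import Data.Nat.Combinatorics using (_C_; nCk≡n!/k![n-k]!; k![n∸k]!∣n!; k>n⇒nCk≡0)
open import Data.Nat.DivMod using (m/n*n≡m)
open import Data.Nat.Induction using (<-rec)
import Data.Nat.Properties as ℕₚ
open import Data.Product using (_×_; _,_; proj₁; proj₂; Σ-syntax)
open import Data.Vec as Vec using (Vec)
open import Relation.Binary.PropositionalEquality as ≡ using (_≡_; _≢_)
open import Relation.Nullary using (¬_; yes; no)

-- Neither `A` nor `_⁻¹` is assumed to respect `≈`. In `Λ` the family `A` is evaluated at the values
-- of `Γ`, which are only `≈` to the derivatives of `f`; every fact about `A` is therefore proved at
-- an arbitrary point agreeing with the derivatives of a series up to `≈`. For `a` in `F*` the
-- reciprocal of `a` is not a power series, but `f` vanishes at 0 as well, so that f/a = (f/x)/(a/x)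
-- still makes sense. This division by x is the origin of the factors 1/(k+1) and of the shifted
-- arguments of `Rhat` in the second version of `Γbar`. The formula for the `cs` is the one for the
-- `ds` with `f` and its inverse exchanged, once the inverse is known to lie in `F*`.

module Expansion {c ℓ} (F : CharZeroField c ℓ) where
  open CharZeroField F
  open FPS F
  open import Algebra.Properties.Ring ring using (-1*x≈-x; x[y-z]≈xy-xz; x∙y⁻¹≈ε⇒x≈y)
  open import Algebra.Solver.Ring.NaturalCoefficients.Default commutativeSemiring using (solve; _:*_; _:+_; _:=_)
  open import Relation.Binary.Reasoning.Setoid setoid

  -- Finite sums

  sum<-cong : ∀ n {f g} → (∀ i → i < n → f i ≈ g i) → sum< n f ≈ sum< n g
  sum<-cong zero    f≈g = refl
  sum<-cong (suc n) f≈g = +-cong (sum<-cong n λ i i<n → f≈g i (ℕₚ.m<n⇒m<1+n i<n)) (f≈g n ℕₚ.≤-refl)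

  sum<-cong′ : ∀ n {f g} → (∀ i → f i ≈ g i) → sum< n f ≈ sum< n g
  sum<-cong′ n f≈g = sum<-cong n λ i _ → f≈g i

  sum<-zero : ∀ n {f} → (∀ i → i < n → f i ≈ 0#) → sum< n f ≈ 0#
  sum<-zero zero    f≈0 = refl
  sum<-zero (suc n) f≈0 =
    trans (+-cong (sum<-zero n λ i i<n → f≈0 i (ℕₚ.m<n⇒m<1+n i<n)) (f≈0 n ℕₚ.≤-refl)) (+-identityˡ 0#)

  sum<-+ : ∀ n f g → sum< n (λ i → f i + g i) ≈ sum< n f + sum< n g
  sum<-+ zero    f g = sym (+-identityˡ 0#)
  sum<-+ (suc n) f g = begin
    sum< n (λ i → f i + g i) + (f n + g n)  ≈⟨ +-congʳ (sum<-+ n f g) ⟩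
    (sum< n f + sum< n g) + (f n + g n)
      ≈⟨ solve 4 (λ a b x y → (a :+ b) :+ (x :+ y) := (a :+ x) :+ (b :+ y)) refl _ _ _ _ ⟩
    (sum< n f + f n) + (sum< n g + g n)     ∎

  *-distribˡ-sum< : ∀ n x f → x * sum< n f ≈ sum< n (λ i → x * f i)
  *-distribˡ-sum< zero    x f = zeroʳ x
  *-distribˡ-sum< (suc n) x f = trans (distribˡ x _ _) (+-congʳ (*-distribˡ-sum< n x f))

  *-distribʳ-sum< : ∀ n x f → sum< n f * x ≈ sum< n (λ i → f i * x)
  *-distribʳ-sum< zero    x f = zeroˡ x
  *-distribʳ-sum< (suc n) x f = trans (distribʳ x _ _) (+-congʳ (*-distribʳ-sum< n x f))

  sum<-swap : ∀ m n (g : ℕ → ℕ → Carrier) → sum< m (λ i → sum< n (λ j → g i j)) ≈ sum< n (λ j → sum< m (λ i → g i j))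
  sum<-swap zero    n g = sym (sum<-zero n λ _ _ → refl)
  sum<-swap (suc m) n g =
    trans (+-congʳ (sum<-swap m n g)) (sym (sum<-+ n (λ j → sum< m (λ i → g i j)) (g m)))

  sum<-front : ∀ n f → sum< (suc n) f ≈ f 0 + sum< n (λ i → f (suc i))
  sum<-front zero    f = +-comm 0# (f 0)
  sum<-front (suc n) f = trans (+-congʳ (sum<-front n f)) (+-assoc _ _ _)

  sum<-extend : ∀ {m n f} → m ≤ n → (∀ i → m ≤ i → i < n → f i ≈ 0#) → sum< n f ≈ sum< m f
  sum<-extend {m} {n} {f} m≤n tail≈0 = go (ℕₚ.≤⇒≤′ m≤n) tail≈0
    where
    go : ∀ {n} → m ℕ.≤′ n → (∀ i → m ≤ i → i < n → f i ≈ 0#) → sum< n f ≈ sum< m f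
    go ℕ.≤′-refl       _  = refl
    go (ℕ.≤′-step m≤n) t≈0 = trans
      (+-cong (go m≤n λ i m≤i i<n → t≈0 i m≤i (ℕₚ.m<n⇒m<1+n i<n)) (t≈0 _ (ℕₚ.≤′⇒≤ m≤n) ℕₚ.≤-refl))
      (+-identityʳ _)

  sum<-reverse : ∀ n f → sum< (suc n) f ≈ sum< (suc n) (λ i → f (n ∸ i))
  sum<-reverse zero    f = refl
  sum<-reverse (suc n) f = begin
    sum< (suc (suc n)) f                                    ≈⟨ sum<-front (suc n) f ⟩
    f 0 + sum< (suc n) (λ i → f (suc i))                    ≈⟨ +-congˡ (sum<-reverse n _) ⟩
    f 0 + sum< (suc n) (λ i → f (suc (n ∸ i)))              ≈⟨ +-comm _ _ ⟩
    sum< (suc n) (λ i → f (suc (n ∸ i))) + f 0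
      ≈⟨ +-cong (sum<-cong (suc n) λ { i (s≤s i≤n) → reflexive (≡.cong f (≡.sym (ℕₚ.+-∸-assoc 1 i≤n))) })
                (reflexive (≡.cong f (≡.sym (ℕₚ.n∸n≡0 n)))) ⟩
    sum< (suc (suc n)) (λ i → f (suc n ∸ i))                ∎

  -- Both sides run over the pairs with `j + l ≤ n`. Passing from `n` to `suc n` lengthens every row
  -- by one term and adds one new row.
  sum<-triangle : ∀ n (g : ℕ → ℕ → Carrier) → sum< (suc n) (λ i → sum< (suc i) (λ j → g j (i ∸ j)))
                        ≈ sum< (suc n) (λ j → sum< (suc (n ∸ j)) (λ l → g j l))
  sum<-triangle zero    g = refl
  sum<-triangle (suc n) g = begin
    sum< (suc n) (λ i → sum< (suc i) (λ j → g j (i ∸ j)))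
      + (sum< (suc n) (λ j → g j (suc n ∸ j)) + g (suc n) (n ∸ n))
      ≈⟨ +-assoc _ _ _ ⟨
    sum< (suc n) (λ i → sum< (suc i) (λ j → g j (i ∸ j)))
      + sum< (suc n) (λ j → g j (suc n ∸ j)) + g (suc n) (n ∸ n)
      ≈⟨ +-cong (+-congʳ (sum<-triangle n g)) last ⟩
    sum< (suc n) (λ j → sum< (suc (n ∸ j)) (g j)) + sum< (suc n) (λ j → g j (suc n ∸ j))
      + sum< (suc (n ∸ n)) (g (suc n))
      ≈⟨ +-congʳ (sum<-+ (suc n) _ _) ⟨
    sum< (suc n) (λ j → sum< (suc (n ∸ j)) (g j) + g j (suc n ∸ j)) + sum< (suc (n ∸ n)) (g (suc n))
      ≈⟨ +-congʳ (sum<-cong (suc n) λ { j (s≤s j≤n) → reflexive (row j j≤n) }) ⟩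
    sum< (suc (suc n)) (λ j → sum< (suc (suc n ∸ j)) (g j))  ∎
    where
    last : g (suc n) (n ∸ n) ≈ sum< (suc (n ∸ n)) (g (suc n))
    last rewrite ℕₚ.n∸n≡0 n = sym (+-identityˡ _)
    row : ∀ j → j ≤ n → sum< (suc (n ∸ j)) (g j) + g j (suc n ∸ j) ≡ sum< (suc (suc n ∸ j)) (g j)
    row j j≤n rewrite ℕₚ.+-∸-assoc 1 j≤n = ≡.refl

  sum<-single : ∀ {n k f} → k < n → (∀ i → i < n → i ≢ k → f i ≈ 0#) → sum< n f ≈ f k
  sum<-single {suc n} {k} {f} k<1+n others with k ℕₚ.≟ n
  ... | yes ≡.refl = trans
    (+-congʳ (sum<-zero k λ i i<k → others i (ℕₚ.m<n⇒m<1+n i<k) (ℕₚ.<⇒≢ i<k))) (+-identityˡ _)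
  ... | no k≢n = trans
    (+-cong (sum<-single (ℕₚ.≤∧≢⇒< (ℕ.s≤s⁻¹ k<1+n) k≢n) λ i i<n → others i (ℕₚ.m<n⇒m<1+n i<n))
            (others n ℕₚ.≤-refl λ n≡k → k≢n (≡.sym n≡k)))
    (+-identityʳ _)

  -- Trades the truncated sums of the definitions for full ones. The closed form `g` has to match
  -- `f` only on `k ≤ j ≤ n`, which is where `Bell-der` is available.
  sumFromTo-extend : ∀ k n {f g} → (∀ j → k ≤ j → j ≤ n → f j ≈ g j) → (∀ j → j < k → g j ≈ 0#) →
                     sumFromTo k n f ≈ sum< (suc n) g
  sumFromTo-extend k n {f} {g} f≈g g≈0 = sum<-cong (suc n) λ { j (s≤s j≤n) → term j j≤n }
    where
    term : ∀ j → j ≤ n → (if k ≤ᵇ j then f j else 0#) ≈ g j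
    term j j≤n with k ≤ᵇ j in eq
    ... | true  = f≈g j (ℕₚ.≤ᵇ⇒≤ k j (≡.subst T (≡.sym eq) _)) j≤n
    ... | false = sym (g≈0 j (ℕₚ.≰⇒> λ k≤j → ≡.subst T eq (ℕₚ.≤⇒≤ᵇ k≤j)))

  -- Factorials

  natK-+ : ∀ m n → natK (m ℕ.+ n) ≈ natK m + natK n
  natK-+ zero    n = sym (+-identityˡ _)
  natK-+ (suc m) n = trans (+-congˡ (natK-+ m n)) (sym (+-assoc _ _ _))

  natK-* : ∀ m n → natK (m ℕ.* n) ≈ natK m * natK n
  natK-* zero    n = sym (zeroˡ _)
  natK-* (suc m) n = begin
    natK (n ℕ.+ m ℕ.* n)       ≈⟨ natK-+ n (m ℕ.* n) ⟩
    natK n + natK (m ℕ.* n)    ≈⟨ +-cong (sym (*-identityˡ _)) (natK-* m n) ⟩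
    1# * natK n + natK m * natK n  ≈⟨ distribʳ _ _ _ ⟨
    natK (suc m) * natK n      ∎

  natK-^ : ∀ m r → natK (m ℕ.^ r) ≈ natK m ^ r
  natK-^ m zero    = +-identityʳ 1#
  natK-^ m (suc r) = trans (natK-* m (m ℕ.^ r)) (*-congˡ (natK-^ m r))

  natK≉0 : ∀ n → NonZero n → ¬ (natK n ≈ 0#)
  natK≉0 (suc n) _ = charZero n

  1≉0 : ¬ (1# ≈ 0#)
  1≉0 1≈0 = charZero 0 (trans (+-identityʳ 1#) 1≈0)

  *-cancelˡ : ∀ x {y z} → ¬ (x ≈ 0#) → x * y ≈ x * z → y ≈ z
  *-cancelˡ x {y} {z} x≉0 xy≈xz = begin
    y              ≈⟨ lemma y ⟩
    x ⁻¹ * (x * y) ≈⟨ *-congˡ xy≈xz ⟩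
    x ⁻¹ * (x * z) ≈⟨ lemma z ⟨
    z              ∎
    where
    lemma : ∀ w → w ≈ x ⁻¹ * (x * w)
    lemma w = begin
      w              ≈⟨ *-identityˡ w ⟨
      1# * w         ≈⟨ *-congʳ (⁻¹-inverse x x≉0) ⟨
      x * x ⁻¹ * w   ≈⟨ solve 3 (λ x i w → x :* i :* w := i :* (x :* w)) refl _ _ _ ⟩
      x ⁻¹ * (x * w) ∎

  *≉0 : ∀ {x y} → ¬ (x ≈ 0#) → ¬ (y ≈ 0#) → ¬ (x * y ≈ 0#)
  *≉0 {x} x≉0 y≉0 xy≈0 = y≉0 (*-cancelˡ x x≉0 (trans xy≈0 (sym (zeroʳ x))))

  ^≉0 : ∀ {x} n → ¬ (x ≈ 0#) → ¬ (x ^ n ≈ 0#)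
  ^≉0 zero    _   = 1≉0
  ^≉0 (suc n) x≉0 = *≉0 x≉0 (^≉0 n x≉0)

  ≉0-resp : ∀ {x y} → x ≈ y → ¬ (x ≈ 0#) → ¬ (y ≈ 0#)
  ≉0-resp x≈y x≉0 y≈0 = x≉0 (trans x≈y y≈0)

  ^-cong : ∀ {x y} n → x ≈ y → x ^ n ≈ y ^ n
  ^-cong zero    x≈y = refl
  ^-cong (suc n) x≈y = *-cong x≈y (^-cong n x≈y)

  *-^ : ∀ x y n → (x * y) ^ n ≈ x ^ n * y ^ n
  *-^ x y zero    = sym (*-identityˡ 1#)
  *-^ x y (suc n) = trans (*-congˡ (*-^ x y n))
    (solve 4 (λ x y a b → x :* y :* (a :* b) := x :* a :* (y :* b)) refl _ _ _ _)

  -- Replaces congruence of `_⁻¹`: an inverse is identified by its defining product.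
  ⁻¹-unique : ∀ {x y} → ¬ (x ≈ 0#) → x * y ≈ 1# → x ⁻¹ ≈ y
  ⁻¹-unique {x} x≉0 xy≈1 = *-cancelˡ x x≉0 (trans (⁻¹-inverse x x≉0) (sym xy≈1))

  fact ifact : ℕ → Carrier
  fact n  = natK (n !)
  ifact n = natK (n !) ⁻¹

  fact≉0 : ∀ n → ¬ (fact n ≈ 0#)
  fact≉0 n = natK≉0 (n !) (n ℕₚ.!≢0)

  fact*ifact : ∀ n → fact n * ifact n ≈ 1#
  fact*ifact n = ⁻¹-inverse (fact n) (fact≉0 n)

  fact-C : ∀ {n k} → k ≤ n → natK (n C k) * (fact k * fact (n ∸ k)) ≈ fact n
  fact-C {n} {k} k≤n = begin
    natK (n C k) * (fact k * fact (n ∸ k))      ≈⟨ *-congˡ (natK-* (k !) ((n ∸ k) !)) ⟨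
    natK (n C k) * natK (k ! ℕ.* (n ∸ k) !)     ≈⟨ natK-* (n C k) _ ⟨
    natK ((n C k) ℕ.* (k ! ℕ.* (n ∸ k) !))      ≈⟨ reflexive (≡.cong natK C-fact) ⟩
    fact n                                      ∎
    where
    instance _ = k ℕₚ.!* (n ∸ k) !≢0
    C-fact : (n C k) ℕ.* (k ! ℕ.* (n ∸ k) !) ≡ n !
    C-fact = ≡.trans (≡.cong (ℕ._* (k ! ℕ.* (n ∸ k) !)) (nCk≡n!/k![n-k]! k≤n)) (m/n*n≡m (k![n∸k]!∣n! k≤n))

  ifact-C : ∀ {n k} → k ≤ n → ifact n * natK (n C k) ≈ ifact k * ifact (n ∸ k)
  ifact-C {n} {k} k≤n = *-cancelˡ (fact n) (fact≉0 n) (begin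
    fact n * (ifact n * natK (n C k))  ≈⟨ *-assoc _ _ _ ⟨
    fact n * ifact n * natK (n C k)    ≈⟨ *-congʳ (fact*ifact n) ⟩
    1# * natK (n C k)                  ≈⟨ *-identityˡ _ ⟩
    natK (n C k)                       ≈⟨ *-identityʳ _ ⟨
    natK (n C k) * 1#                  ≈⟨ *-congˡ (trans (*-cong (fact*ifact k) (fact*ifact (n ∸ k))) (*-identityˡ 1#)) ⟨
    natK (n C k) * ((fact k * ifact k) * (fact (n ∸ k) * ifact (n ∸ k)))
      ≈⟨ solve 5 (λ b x y z w → b :* ((x :* y) :* (z :* w)) := (b :* (x :* z)) :* (y :* w)) refl _ _ _ _ _ ⟩
    (natK (n C k) * (fact k * fact (n ∸ k))) * (ifact k * ifact (n ∸ k)) ≈⟨ *-congʳ (fact-C k≤n) ⟩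
    fact n * (ifact k * ifact (n ∸ k))  ∎)

  -- Power series

  infix 4 _≈S_
  _≈S_ : Series → Series → Set ℓ
  s ≈S t = ∀ m → s m ≈ t m

  _+S_ : Series → Series → Series
  (s +S t) m = s m + t m

  0S : Series
  0S _ = 0#

  ⋆-cong-≤ : ∀ n {s s′ t t′} → (∀ i → i ≤ n → s i ≈ s′ i) → (∀ i → i ≤ n → t i ≈ t′ i) →
             (s ⋆ t) n ≈ (s′ ⋆ t′) n
  ⋆-cong-≤ n s≈ t≈ = sum<-cong (suc n) λ { i (s≤s i≤n) → *-cong (s≈ i i≤n) (t≈ (n ∸ i) (ℕₚ.m∸n≤m n i)) }

  ⋆-cong : ∀ {s s′ t t′} → s ≈S s′ → t ≈S t′ → (s ⋆ t) ≈S (s′ ⋆ t′)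
  ⋆-cong s≈ t≈ n = ⋆-cong-≤ n (λ i _ → s≈ i) (λ i _ → t≈ i)

  ⋆-comm : ∀ s t → (s ⋆ t) ≈S (t ⋆ s)
  ⋆-comm s t n = trans (sum<-reverse n _) (sum<-cong (suc n) λ { i (s≤s i≤n) →
    trans (*-congˡ (reflexive (≡.cong t (ℕₚ.m∸[m∸n]≡n i≤n)))) (*-comm _ _) })

  ⋆-assoc : ∀ s t u → ((s ⋆ t) ⋆ u) ≈S (s ⋆ (t ⋆ u))
  ⋆-assoc s t u n = begin
    sum< (suc n) (λ i → sum< (suc i) (λ j → s j * t (i ∸ j)) * u (n ∸ i))
      ≈⟨ sum<-cong′ (suc n) (λ i → trans (*-distribʳ-sum< (suc i) (u (n ∸ i)) _)
           (sum<-cong (suc i) λ { j (s≤s j≤i) →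
              *-congˡ (reflexive (≡.cong (λ p → u (n ∸ p)) (≡.sym (ℕₚ.m+[n∸m]≡n j≤i)))) })) ⟩
    sum< (suc n) (λ i → sum< (suc i) (λ j → g j (i ∸ j)))       ≈⟨ sum<-triangle n g ⟩
    sum< (suc n) (λ j → sum< (suc (n ∸ j)) (g j))
      ≈⟨ sum<-cong′ (suc n) (λ j → trans
           (sum<-cong′ (suc (n ∸ j)) λ l → trans (*-assoc _ _ _)
              (*-congˡ (*-congˡ (reflexive (≡.cong u (≡.sym (ℕₚ.∸-+-assoc n j l)))))))
           (sym (*-distribˡ-sum< (suc (n ∸ j)) (s j) _))) ⟩
    sum< (suc n) (λ j → s j * (t ⋆ u) (n ∸ j))                   ∎
    where
    g : ℕ → ℕ → Carrier
    g j l = s j * t l * u (n ∸ (j ℕ.+ l))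

  ⋆-identityˡ : ∀ s → (oneS ⋆ s) ≈S s
  ⋆-identityˡ s n = begin
    (oneS ⋆ s) n                              ≈⟨ sum<-front n _ ⟩
    1# * s n + sum< n (λ i → 0# * s (n ∸ suc i))
      ≈⟨ +-cong (*-identityˡ _) (sum<-zero n λ i _ → zeroˡ _) ⟩
    s n + 0#                                  ≈⟨ +-identityʳ _ ⟩
    s n                                       ∎

  ⋆-distribʳ : ∀ u s t → ((s +S t) ⋆ u) ≈S ((s ⋆ u) +S (t ⋆ u))
  ⋆-distribʳ u s t n = trans (sum<-cong′ (suc n) λ i → distribʳ _ _ _) (sum<-+ (suc n) _ _)

  ⋆-zeroˡ : ∀ s → (0S ⋆ s) ≈S 0S
  ⋆-zeroˡ s n = sum<-zero (suc n) λ i _ → zeroˡ _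

  -- Bundled so that the general binomial theorem for commutative semirings applies to series.
  ⋆-commutativeSemiring : CommutativeSemiring c ℓ
  ⋆-commutativeSemiring = record
    { Carrier = Series ; _≈_ = _≈S_ ; _+_ = _+S_ ; _*_ = _⋆_ ; 0# = 0S ; 1# = oneS
    ; isCommutativeSemiring = record
      { isSemiring = record
        { isSemiringWithoutAnnihilatingZero = record
          { +-isCommutativeMonoid = record
            { isMonoid = record
              { isSemigroup = record
                { isMagma = record
                  { isEquivalence = record
                    { refl = λ _ → refl ; sym = λ p m → sym (p m) ; trans = λ p q m → trans (p m) (q m) }
                  ; ∙-cong = λ p q m → +-cong (p m) (q m) }
                ; assoc = λ s t u m → +-assoc (s m) (t m) (u m) }
              ; identity = (λ s m → +-identityˡ (s m)) , (λ s m → +-identityʳ (s m)) }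
            ; comm = λ s t m → +-comm (s m) (t m) }
          ; *-cong = ⋆-cong
          ; *-assoc = ⋆-assoc
          ; *-identity = ⋆-identityˡ , (λ s m → trans (⋆-comm s oneS m) (⋆-identityˡ s m))
          ; distrib = (λ u s t m → trans (⋆-comm u (s +S t) m)
                        (trans (⋆-distribʳ u s t m) (+-cong (⋆-comm s u m) (⋆-comm t u m))))
                    , ⋆-distribʳ }
        ; zero = ⋆-zeroˡ , (λ s m → trans (⋆-comm s 0S m) (⋆-zeroˡ s m)) }
      ; *-comm = ⋆-comm } }

  -- The coefficients of a power up to degree `n` depend only on those of the base up to degree `n`.
  -- This allows a series to be replaced by a finite segment of itself.
  ^S-cong-≤ : ∀ n k {s t} → (∀ i → i ≤ n → s i ≈ t i) → ∀ i → i ≤ n → (s ^S k) i ≈ (t ^S k) i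
  ^S-cong-≤ n zero    s≈t i i≤n = refl
  ^S-cong-≤ n (suc k) s≈t i i≤n = ⋆-cong-≤ i
    (λ j j≤i → s≈t j (ℕₚ.≤-trans j≤i i≤n)) (λ j j≤i → ^S-cong-≤ n k s≈t j (ℕₚ.≤-trans j≤i i≤n))

  ^S-order : ∀ {s} → s 0 ≈ 0# → ∀ k m → m < k → (s ^S k) m ≈ 0#
  ^S-order {s} s0≈0 (suc k) m (s≤s m≤k) = sum<-zero (suc m) term
    where
    term : ∀ i → i < suc m → s i * (s ^S k) (m ∸ i) ≈ 0#
    term zero    _         = trans (*-congʳ s0≈0) (zeroˡ _)
    term (suc i) (s≤s i<m) = trans
      (*-congˡ (^S-order s0≈0 k (m ∸ suc i)
        (ℕₚ.<-≤-trans (ℕₚ.∸-monoʳ-< (s≤s z≤n) i<m) m≤k)))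
      (zeroʳ _)

  -- The binomial theorem in divided powers

  private
    module 𝕊 = CommutativeSemiring ⋆-commutativeSemiring
  open import Algebra.Properties.CommutativeSemiring.Binomial ⋆-commutativeSemiring
    using () renaming (theorem to binomial-theorem)
  open import Algebra.Definitions.RawSemiring 𝕊.rawSemiring
    using () renaming (_^_ to _^𝕊_; _×_ to _×𝕊_; sum to sum𝕊)

  ^S≡^𝕊 : ∀ s k → s ^S k ≡ s ^𝕊 k
  ^S≡^𝕊 s zero    = ≡.refl
  ^S≡^𝕊 s (suc k) = ≡.cong (s ⋆_) (^S≡^𝕊 s k)

  ×𝕊-coeff : ∀ n s m → (n ×𝕊 s) m ≈ natK n * s m
  ×𝕊-coeff zero    s m = sym (zeroˡ _)
  ×𝕊-coeff (suc n) s m =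
    trans (+-cong (sym (*-identityˡ _)) (×𝕊-coeff n s m)) (sym (distribʳ _ _ _))

  sum𝕊-coeff : ∀ n (g : ℕ → Series) m → sum𝕊 {n} (λ i → g (toℕ i)) m ≈ sum< n (λ i → g i m)
  sum𝕊-coeff zero    g m = refl
  sum𝕊-coeff (suc n) g m =
    trans (+-congˡ (sum𝕊-coeff n (λ i → g (suc i)) m)) (sym (sum<-front n _))

  -- Dividing by k! turns the binomial coefficient into 1/r! times 1/(k-r)!. Iterated, this yields
  -- exactly the product of the 1/r_i! in a Bell polynomial, and no multinomial coefficients have to
  -- be handled.
  binomial-divided : ∀ k s t m → ifact k * ((s +S t) ^S k) m ≈
    sum< (suc k) (λ r → ifact r * ifact (k ∸ r) * ((s ^S r) ⋆ (t ^S (k ∸ r))) m)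
  binomial-divided k s t m = begin
    ifact k * ((s +S t) ^S k) m
      ≈⟨ *-congˡ (trans (reflexive (≡.cong (λ u → u m) (^S≡^𝕊 (s +S t) k))) (binomial-theorem k s t m)) ⟩
    ifact k * sum𝕊 {suc k} (λ i → (k C toℕ i) ×𝕊 ((s ^𝕊 toℕ i) ⋆ (t ^𝕊 (k ∸ toℕ i)))) m
      ≈⟨ *-congˡ (sum𝕊-coeff (suc k) (λ r → (k C r) ×𝕊 ((s ^𝕊 r) ⋆ (t ^𝕊 (k ∸ r)))) m) ⟩
    ifact k * sum< (suc k) (λ r → ((k C r) ×𝕊 ((s ^𝕊 r) ⋆ (t ^𝕊 (k ∸ r)))) m)
      ≈⟨ *-distribˡ-sum< (suc k) _ _ ⟩
    sum< (suc k) (λ r → ifact k * ((k C r) ×𝕊 ((s ^𝕊 r) ⋆ (t ^𝕊 (k ∸ r)))) m)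
      ≈⟨ sum<-cong (suc k) (λ { r (s≤s r≤k) → begin
           ifact k * ((k C r) ×𝕊 ((s ^𝕊 r) ⋆ (t ^𝕊 (k ∸ r)))) m
             ≈⟨ *-congˡ (×𝕊-coeff (k C r) _ m) ⟩
           ifact k * (natK (k C r) * ((s ^𝕊 r) ⋆ (t ^𝕊 (k ∸ r))) m)
             ≈⟨ *-assoc _ _ _ ⟨
           ifact k * natK (k C r) * ((s ^𝕊 r) ⋆ (t ^𝕊 (k ∸ r))) m
             ≈⟨ *-cong (ifact-C r≤k) (reflexive (≡.sym (≡.cong₂ (λ u v → (u ⋆ v) m) (^S≡^𝕊 s r) (^S≡^𝕊 t (k ∸ r))))) ⟩
           ifact r * ifact (k ∸ r) * ((s ^S r) ⋆ (t ^S (k ∸ r))) m ∎ }) ⟩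
    sum< (suc k) (λ r → ifact r * ifact (k ∸ r) * ((s ^S r) ⋆ (t ^S (k ∸ r))) m)  ∎

  -- Monomials

  -- Written with the same test as `δ`, so that `δ n k` unfolds to `mono n 1# k` and the lemmas on
  -- monomials also serve for Kronecker deltas.
  mono : ℕ → Carrier → Series
  mono i x n = if i ≡ᵇ n then x else 0#

  mono-cong : ∀ i {x y} → x ≈ y → mono i x ≈S mono i y
  mono-cong i x≈y n with i ≡ᵇ n
  ... | true  = x≈y
  ... | false = refl

  mono-diag : ∀ i x → mono i x i ≈ x
  mono-diag zero    x = refl
  mono-diag (suc i) x = mono-diag i x

  mono-off : ∀ i x n → i ≢ n → mono i x n ≈ 0#
  mono-off zero    x zero    0≢0 = ⊥-elim (0≢0 ≡.refl)
  mono-off zero    x (suc n) _   = refl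
  mono-off (suc i) x zero    _   = refl
  mono-off (suc i) x (suc n) i≢n = mono-off i x n λ i≡n → i≢n (≡.cong suc i≡n)

  mono-* : ∀ i x y n → x * mono i y n ≈ mono i (x * y) n
  mono-* i x y n with i ≡ᵇ n
  ... | true  = refl
  ... | false = zeroʳ x

  mono-suc-⋆-zero : ∀ i x w → (mono (suc i) x ⋆ w) 0 ≈ 0#
  mono-suc-⋆-zero i x w = trans (+-identityˡ _) (zeroˡ _)

  mono-suc-⋆-suc : ∀ i x w n → (mono (suc i) x ⋆ w) (suc n) ≈ (mono i x ⋆ w) n
  mono-suc-⋆-suc i x w n = trans (sum<-front (suc n) _) (trans (+-congʳ (zeroˡ _)) (+-identityˡ _))

  mono-0-⋆ : ∀ x w n → (mono 0 x ⋆ w) n ≈ x * w n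
  mono-0-⋆ x w n =
    trans (sum<-front n _) (trans (+-congˡ (sum<-zero n λ i _ → zeroˡ _)) (+-identityʳ _))

  mono-⋆-mono : ∀ i j x y → (mono i x ⋆ mono j y) ≈S mono (i ℕ.+ j) (x * y)
  mono-⋆-mono zero    j x y n       = trans (mono-0-⋆ x (mono j y) n) (mono-* j x y n)
  mono-⋆-mono (suc i) j x y zero    = mono-suc-⋆-zero i x (mono j y)
  mono-⋆-mono (suc i) j x y (suc n) = trans (mono-suc-⋆-suc i x (mono j y) n) (mono-⋆-mono i j x y n)

  mono-^S : ∀ i x r → (mono i x ^S r) ≈S mono (i ℕ.* r) (x ^ r)
  mono-^S i x zero    rewrite ℕₚ.*-zeroʳ i = λ { zero → refl ; (suc _) → refl }
  mono-^S i x (suc r) m = begin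
    (mono i x ⋆ (mono i x ^S r)) m              ≈⟨ ⋆-cong (λ _ → refl) (mono-^S i x r) m ⟩
    (mono i x ⋆ mono (i ℕ.* r) (x ^ r)) m       ≈⟨ mono-⋆-mono i (i ℕ.* r) x (x ^ r) m ⟩
    mono (i ℕ.+ i ℕ.* r) (x * x ^ r) m          ≈⟨ reflexive (≡.cong (λ p → mono p (x ^ suc r) m) (≡.sym (ℕₚ.*-suc i r))) ⟩
    mono (i ℕ.* suc r) (x ^ suc r) m            ∎

  -- Bell polynomials

  sumK-cong : ∀ {A : Set} (xs : List A) {f g : A → Carrier} → (∀ x → f x ≈ g x) →
              sumK (List.map f xs) ≈ sumK (List.map g xs)
  sumK-cong []       f≈g = refl
  sumK-cong (x ∷ xs) f≈g = +-cong (f≈g x) (sumK-cong xs f≈g)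

  sumK-zero : ∀ {A : Set} (xs : List A) {f : A → Carrier} → (∀ x → f x ≈ 0#) → sumK (List.map f xs) ≈ 0#
  sumK-zero []       f≈0 = refl
  sumK-zero (x ∷ xs) f≈0 = trans (+-cong (f≈0 x) (sumK-zero xs f≈0)) (+-identityˡ 0#)

  sumK-*ˡ : ∀ {A : Set} (xs : List A) x (f : A → Carrier) →
            sumK (List.map (λ v → x * f v) xs) ≈ x * sumK (List.map f xs)
  sumK-*ˡ []       x f = sym (zeroʳ x)
  sumK-*ˡ (v ∷ vs) x f = trans (+-congˡ (sumK-*ˡ vs x f)) (sym (distribˡ _ _ _))

  sumK-sum<-swap : ∀ {A : Set} (xs : List A) n (f : A → ℕ → Carrier) →
    sumK (List.map (λ v → sum< n (f v)) xs) ≈ sum< n (λ r → sumK (List.map (λ v → f v r) xs))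
  sumK-sum<-swap []       n f = sym (sum<-zero n λ _ _ → refl)
  sumK-sum<-swap (v ∷ vs) n f = trans (+-congˡ (sumK-sum<-swap vs n f)) (sym (sum<-+ n _ _))

  sumK-++ : ∀ xs ys → sumK (xs List.++ ys) ≈ sumK xs + sumK ys
  sumK-++ []       ys = sym (+-identityˡ _)
  sumK-++ (x ∷ xs) ys = trans (+-congˡ (sumK-++ xs ys)) (sym (+-assoc _ _ _))

  sumK-concatMap : ∀ {A B : Set} (g : A → List B) (f : B → Carrier) xs →
    sumK (List.map f (List.concatMap g xs)) ≈ sumK (List.map (λ v → sumK (List.map f (g v))) xs)
  sumK-concatMap g f []       = refl
  sumK-concatMap g f (v ∷ vs) = begin
    sumK (List.map f (g v List.++ List.concatMap g vs))
      ≈⟨ reflexive (≡.cong sumK (Listₚ.map-++ f (g v) _)) ⟩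
    sumK (List.map f (g v) List.++ List.map f (List.concatMap g vs))
      ≈⟨ sumK-++ (List.map f (g v)) _ ⟩
    sumK (List.map f (g v)) + sumK (List.map f (List.concatMap g vs))
      ≈⟨ +-congˡ (sumK-concatMap g f vs) ⟩
    sumK (List.map (λ v → sumK (List.map f (g v))) (v ∷ vs))  ∎

  sumK-applyUpTo : ∀ {A : Set} (f : A → Carrier) (g : ℕ → A) n →
    sumK (List.map f (List.applyUpTo g n)) ≈ sum< n (λ r → f (g r))
  sumK-applyUpTo f g zero    = refl
  sumK-applyUpTo f g (suc n) =
    trans (+-congˡ (sumK-applyUpTo f (λ i → g (suc i)) n)) (sym (sum<-front n _))

  -- `allVecs` lets the first entry vary innermost. Here it becomes the outer summation index, as
  -- the binomial theorem requires.
  sumK-allVecs-suc : ∀ l b (f : Vec ℕ (suc l) → Carrier) →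
    sumK (List.map f (allVecs (suc l) b)) ≈
    sum< (suc b) (λ r → sumK (List.map (λ v → f (r Vec.∷ v)) (allVecs l b)))
  sumK-allVecs-suc l b f = begin
    sumK (List.map f (allVecs (suc l) b))
      ≈⟨ sumK-concatMap _ f (allVecs l b) ⟩
    sumK (List.map (λ v → sumK (List.map f (List.map (Vec._∷ v) (List.upTo (suc b))))) (allVecs l b))
      ≈⟨ sumK-cong (allVecs l b) (λ v → trans
           (reflexive (≡.cong sumK (≡.sym (Listₚ.map-∘ (List.upTo (suc b))))))
           (sumK-applyUpTo (λ r → f (r Vec.∷ v)) (λ r → r) (suc b))) ⟩
    sumK (List.map (λ v → sum< (suc b) (λ r → f (r Vec.∷ v))) (allVecs l b))
      ≈⟨ sumK-sum<-swap (allVecs l b) (suc b) _ ⟩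
    sum< (suc b) (λ r → sumK (List.map (λ v → f (r Vec.∷ v)) (allVecs l b)))  ∎

  -- The multinomial theorem and the Bell matrix of a series

  δ-+ : ∀ r n k → r ≤ k → δ (r ℕ.+ n) k ≈ δ n (k ∸ r)
  δ-+ zero    n k       _         = refl
  δ-+ (suc r) n (suc k) (s≤s r≤k) = δ-+ r n k r≤k

  size weight : ∀ {l} → ℕ → Vec ℕ l → ℕ
  size   s v = sumℕ (List.map proj₂ (indexed s v))
  weight s v = sumℕ (List.map (λ p → proj₁ p ℕ.* proj₂ p) (indexed s v))

  denominator : ∀ {l} → ℕ → Vec ℕ l → ℕ
  denominator s v = prodℕ (List.map (λ p → (proj₂ p !) ℕ.* ((proj₁ p !) ℕ.^ proj₂ p)) (indexed s v))

  monomial : ∀ {l} → Series → ℕ → Vec ℕ l → Carrier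
  monomial x s v = prodK (List.map (λ p → x (proj₁ p) ^ proj₂ p) (indexed s v))

  module _ (u : Series) where

    dividedMonomial : ∀ {l} → ℕ → Vec ℕ l → Carrier
    dividedMonomial s Vec.[]      = 1#
    dividedMonomial s (r Vec.∷ v) = ifact r * u s ^ r * dividedMonomial (suc s) v

    -- The part of `u` in degrees `s` to `s + l - 1`, assembled monomial by monomial so that its
    -- recursion follows that of exponent vectors of length `l`.
    segment : ℕ → ℕ → Series
    segment s zero    = 0S
    segment s (suc l) = mono s (u s) +S segment (suc s) l

    segment-below : ∀ s l i → i < s → segment s l i ≈ 0#
    segment-below s zero    i i<s = refl
    segment-below s (suc l) i i<s = trans
      (+-cong (mono-off s (u s) i (ℕₚ.>⇒≢ i<s)) (segment-below (suc s) l i (ℕₚ.m<n⇒m<1+n i<s)))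
      (+-identityˡ 0#)

    segment-inside : ∀ s l i → s ≤ i → i < s ℕ.+ l → segment s l i ≈ u i
    segment-inside s zero i s≤i i<s+0 =
      ⊥-elim (ℕₚ.<⇒≱ i<s+0 (≡.subst (_≤ i) (≡.sym (ℕₚ.+-identityʳ s)) s≤i))
    segment-inside s (suc l) i s≤i i<s+1+l with s ℕₚ.≟ i
    ... | yes ≡.refl = trans
      (+-cong (mono-diag s (u s)) (segment-below (suc s) l s ℕₚ.≤-refl)) (+-identityʳ _)
    ... | no s≢i = trans
      (+-cong (mono-off s (u s) i s≢i)
              (segment-inside (suc s) l i (ℕₚ.≤∧≢⇒< s≤i s≢i) (≡.subst (i <_) (ℕₚ.+-suc s l) i<s+1+l)))
      (+-identityˡ _)

    -- The two kinds of factors of the denominator have separate origins: the powers of i! come from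
    -- passing from derivatives to coefficients of `u`, the r! from passing from powers to divided
    -- powers.
    monomial-der : ∀ {x l} s (v : Vec ℕ l) → (∀ i → s ≤ i → x i ≈ der i u) →
                   monomial x s v ≈ natK (denominator s v) * dividedMonomial s v
    monomial-der s Vec.[] x≈ = sym (trans (*-identityʳ _) (+-identityʳ 1#))
    monomial-der {x} s (r Vec.∷ v) x≈ = begin
      x s ^ r * monomial x (suc s) v
        ≈⟨ *-cong (trans (^-cong r (x≈ s ℕₚ.≤-refl)) (*-^ (fact s) (u s) r))
                  (monomial-der (suc s) v λ i s<i → x≈ i (ℕₚ.<⇒≤ s<i)) ⟩
      (fact s ^ r * u s ^ r) * (D * M)
        ≈⟨ *-identityˡ _ ⟨
      1# * ((fact s ^ r * u s ^ r) * (D * M))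
        ≈⟨ *-congʳ (fact*ifact r) ⟨
      (fact r * ifact r) * ((fact s ^ r * u s ^ r) * (D * M))
        ≈⟨ solve 6 (λ a b c d e f → (a :* b) :* ((c :* d) :* (e :* f)) := ((a :* c) :* e) :* ((b :* d) :* f))
             refl _ _ _ _ _ _ ⟩
      ((fact r * fact s ^ r) * D) * ((ifact r * u s ^ r) * M)
        ≈⟨ *-congʳ (*-congʳ (trans (natK-* (r !) ((s !) ℕ.^ r)) (*-congˡ (natK-^ (s !) r)))) ⟨
      (natK ((r !) ℕ.* ((s !) ℕ.^ r)) * D) * ((ifact r * u s ^ r) * M)
        ≈⟨ *-congʳ (natK-* ((r !) ℕ.* ((s !) ℕ.^ r)) (denominator (suc s) v)) ⟨
      natK (denominator s (r Vec.∷ v)) * dividedMonomial s (r Vec.∷ v)  ∎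
      where
      D M : Carrier
      D = natK (denominator (suc s) v)
      M = dividedMonomial (suc s) v

    denominator≢0 : ∀ {l} s (v : Vec ℕ l) → NonZero (denominator s v)
    denominator≢0 s Vec.[]      = _
    denominator≢0 s (r Vec.∷ v) =
      ℕₚ.m*n≢0 ((r !) ℕ.* ((s !) ℕ.^ r)) (denominator (suc s) v)
        {{ℕₚ.m*n≢0 (r !) ((s !) ℕ.^ r) {{r ℕₚ.!≢0}} {{ℕₚ.m^n≢0 (s !) r {{s ℕₚ.!≢0}}}}}}
        {{denominator≢0 (suc s) v}}

    -- The contribution of one exponent vector to the coefficient of degree `m` in u^k/k!. Of the
    -- two tests in `bellTerm`, the one on the size stays a `δ`, while the one on the weight becomes
    -- the degree of a monomial, so that it is respected by multiplication of series.
    sized : ∀ {l} → ℕ → ℕ → ℕ → Vec ℕ l → Carrier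
    sized s k m v = δ (size s v) k * mono (weight s v) (dividedMonomial s v) m

    sized-∷ : ∀ {l} s k m r (v : Vec ℕ l) → sized s k m (r Vec.∷ v) ≈
      δ (r ℕ.+ size (suc s) v) k *
        (ifact r * ((mono s (u s) ^S r) ⋆ mono (weight (suc s) v) (dividedMonomial (suc s) v)) m)
    sized-∷ s k m r v = *-congˡ (begin
      mono (s ℕ.* r ℕ.+ W) (ifact r * u s ^ r * M) m
        ≈⟨ mono-cong (s ℕ.* r ℕ.+ W) (*-assoc _ _ _) m ⟩
      mono (s ℕ.* r ℕ.+ W) (ifact r * (u s ^ r * M)) m
        ≈⟨ mono-* (s ℕ.* r ℕ.+ W) _ _ m ⟨
      ifact r * mono (s ℕ.* r ℕ.+ W) (u s ^ r * M) m
        ≈⟨ *-congˡ (mono-⋆-mono (s ℕ.* r) W (u s ^ r) M m) ⟨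
      ifact r * (mono (s ℕ.* r) (u s ^ r) ⋆ mono W M) m
        ≈⟨ *-congˡ (⋆-cong {t = mono W M} (mono-^S s (u s) r) (λ _ → refl) m) ⟨
      ifact r * ((mono s (u s) ^S r) ⋆ mono W M) m  ∎)
      where
      W : ℕ
      W = weight (suc s) v
      M : Carrier
      M = dividedMonomial (suc s) v

    -- Splitting off the first entry of the vector is the binomial theorem for
    -- the first monomial plus the rest; the bound b is harmless since k ≤ b.
    multinomial-divided : ∀ l b s k m → k ≤ b →
      sumK (List.map (sized s k m) (allVecs l b)) ≈ ifact k * (segment s l ^S k) m
    multinomial-divided zero b s zero m _ = begin
      1# * mono 0 1# m + 0#   ≈⟨ trans (+-identityʳ _) (*-identityˡ _) ⟩
      mono 0 1# m             ≈⟨ mono-one m ⟩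
      oneS m                  ≈⟨ *-identityˡ _ ⟨
      1# * oneS m             ≈⟨ *-congʳ (⁻¹-unique (fact≉0 0) (trans (*-identityʳ _) (+-identityʳ 1#))) ⟨
      ifact 0 * oneS m        ∎
      where
      mono-one : mono 0 1# ≈S oneS
      mono-one zero    = refl
      mono-one (suc _) = refl
    multinomial-divided zero b s (suc k) m _ = begin
      0# * mono 0 1# m + 0#   ≈⟨ trans (+-identityʳ _) (zeroˡ _) ⟩
      0#                      ≈⟨ zeroʳ _ ⟨
      ifact (suc k) * 0#      ≈⟨ *-congˡ (⋆-zeroˡ (0S ^S k) m) ⟨
      ifact (suc k) * (0S ⋆ (0S ^S k)) m  ∎
    multinomial-divided (suc l) b s k m k≤b = begin
      sumK (List.map (sized s k m) (allVecs (suc l) b))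
        ≈⟨ sumK-allVecs-suc l b (sized s k m) ⟩
      sum< (suc b) (λ r → sumK (List.map (λ v → sized s k m (r Vec.∷ v)) (allVecs l b)))
        ≈⟨ sum<-extend (s≤s k≤b) (λ r k<r _ → sumK-zero (allVecs l b) λ v → trans
             (*-congʳ (mono-off (r ℕ.+ size (suc s) v) 1# k
               (ℕₚ.>⇒≢ (ℕₚ.<-≤-trans k<r (ℕₚ.m≤m+n r _)))))
             (zeroˡ _)) ⟩
      sum< (suc k) (λ r → sumK (List.map (λ v → sized s k m (r Vec.∷ v)) (allVecs l b)))
        ≈⟨ sum<-cong (suc k) (λ { r (s≤s r≤k) → row r r≤k }) ⟩
      sum< (suc k) (λ r → ifact r * ifact (k ∸ r) * ((mono s (u s) ^S r) ⋆ (segment (suc s) l ^S (k ∸ r))) m)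
        ≈⟨ binomial-divided k (mono s (u s)) (segment (suc s) l) m ⟨
      ifact k * (segment s (suc l) ^S k) m  ∎
      where
      row : ∀ r → r ≤ k → sumK (List.map (λ v → sized s k m (r Vec.∷ v)) (allVecs l b)) ≈
        ifact r * ifact (k ∸ r) * ((mono s (u s) ^S r) ⋆ (segment (suc s) l ^S (k ∸ r))) m
      row r r≤k = begin
        sumK (List.map (λ v → sized s k m (r Vec.∷ v)) (allVecs l b))
          ≈⟨ sumK-cong (allVecs l b) (λ v → begin
               sized s k m (r Vec.∷ v)
                 ≈⟨ sized-∷ s k m r v ⟩
               δ (r ℕ.+ size (suc s) v) k * (ifact r * (p ⋆ w v) m)
                 ≈⟨ *-congʳ (δ-+ r (size (suc s) v) k r≤k) ⟩
               δ (size (suc s) v) (k ∸ r) * (ifact r * (p ⋆ w v) m)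
                 ≈⟨ solve 3 (λ a b c → a :* (b :* c) := b :* (a :* c)) refl _ _ _ ⟩
               ifact r * (δ (size (suc s) v) (k ∸ r) * (p ⋆ w v) m)
                 ≈⟨ *-congˡ (trans (*-distribˡ-sum< (suc m) _ _) (sum<-cong′ (suc m) λ i →
                      solve 3 (λ a b c → a :* (b :* c) := b :* (a :* c)) refl _ _ _)) ⟩
               ifact r * sum< (suc m) (λ i → p i * sized (suc s) (k ∸ r) (m ∸ i) v)  ∎) ⟩
        sumK (List.map (λ v → ifact r * sum< (suc m) (λ i → p i * sized (suc s) (k ∸ r) (m ∸ i) v)) (allVecs l b))
          ≈⟨ sumK-*ˡ (allVecs l b) (ifact r) _ ⟩
        ifact r * sumK (List.map (λ v → sum< (suc m) (λ i → p i * sized (suc s) (k ∸ r) (m ∸ i) v)) (allVecs l b))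
          ≈⟨ *-congˡ (sumK-sum<-swap (allVecs l b) (suc m) _) ⟩
        ifact r * sum< (suc m) (λ i → sumK (List.map (λ v → p i * sized (suc s) (k ∸ r) (m ∸ i) v) (allVecs l b)))
          ≈⟨ *-congˡ (sum<-cong′ (suc m) λ i → begin
               sumK (List.map (λ v → p i * sized (suc s) (k ∸ r) (m ∸ i) v) (allVecs l b))
                 ≈⟨ sumK-*ˡ (allVecs l b) (p i) _ ⟩
               p i * sumK (List.map (sized (suc s) (k ∸ r) (m ∸ i)) (allVecs l b))
                 ≈⟨ *-congˡ (multinomial-divided l b (suc s) (k ∸ r) (m ∸ i) (ℕₚ.≤-trans (ℕₚ.m∸n≤m k r) k≤b)) ⟩
               p i * (ifact (k ∸ r) * q (m ∸ i))
                 ≈⟨ solve 3 (λ a b c → a :* (b :* c) := b :* (a :* c)) refl _ _ _ ⟩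
               ifact (k ∸ r) * (p i * q (m ∸ i))  ∎) ⟩
        ifact r * sum< (suc m) (λ i → ifact (k ∸ r) * (p i * q (m ∸ i)))
          ≈⟨ *-congˡ (*-distribˡ-sum< (suc m) _ _) ⟨
        ifact r * (ifact (k ∸ r) * (p ⋆ q) m)
          ≈⟨ *-assoc _ _ _ ⟨
        ifact r * ifact (k ∸ r) * (p ⋆ q) m  ∎
        where
        p q : Series
        p = mono s (u s) ^S r
        q = segment (suc s) l ^S (k ∸ r)
        w : Vec ℕ l → Series
        w v = mono (weight (suc s) v) (dividedMonomial (suc s) v)

    bellTerm-der : ∀ {x} n k → (∀ i → 1 ≤ i → x i ≈ der i u) → ∀ v →
                   bellTerm n k x v ≈ fact n * sized 1 k n v
    bellTerm-der {x} n k x≈ v = indicator (size 1 v ≡ᵇ k) (weight 1 v ≡ᵇ n) (trans (*-assoc _ _ _)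
      (*-congˡ (begin
        D ⁻¹ * monomial x 1 v              ≈⟨ *-congˡ (monomial-der 1 v x≈) ⟩
        D ⁻¹ * (D * dividedMonomial 1 v)   ≈⟨ *-assoc _ _ _ ⟨
        D ⁻¹ * D * dividedMonomial 1 v
          ≈⟨ *-congʳ (trans (*-comm _ _) (⁻¹-inverse D (natK≉0 _ (denominator≢0 1 v)))) ⟩
        1# * dividedMonomial 1 v           ≈⟨ *-identityˡ _ ⟩
        dividedMonomial 1 v                ∎)))
      where
      D : Carrier
      D = natK (denominator 1 v)
      indicator : ∀ p q {t y z} → t ≈ y * z →
        (if p ∧ q then t else 0#) ≈ y * ((if p then 1# else 0#) * (if q then z else 0#))
      indicator true  true  t≈yz = trans t≈yz (*-congˡ (sym (*-identityˡ _)))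
      indicator true  false _    = sym (trans (*-congˡ (zeroʳ _)) (zeroʳ _))
      indicator false q     _    = sym (trans (*-congˡ (zeroˡ _)) (zeroʳ _))

    -- The exponents in `Bell n k` are bounded by `n`, whence `k ≤ n`. Agreement of `x` with the
    -- derivatives is asked from index 1 on, so that the lemma also covers `Rhat`, where index 0
    -- holds a nonzero constant that is not part of `u`.
    Bell-der : ∀ {x} → u 0 ≈ 0# → (∀ i → 1 ≤ i → x i ≈ der i u) → ∀ {n k} → k ≤ n →
               Bell n k x ≈ fact n * (ifact k * (u ^S k) n)
    Bell-der {x} u0≈0 x≈ {n} {k} k≤n = begin
      Bell n k x
        ≈⟨ sumK-cong (allVecs n n) (bellTerm-der n k x≈) ⟩
      sumK (List.map (λ v → fact n * sized 1 k n v) (allVecs n n))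
        ≈⟨ sumK-*ˡ (allVecs n n) (fact n) _ ⟩
      fact n * sumK (List.map (sized 1 k n) (allVecs n n))
        ≈⟨ *-congˡ (multinomial-divided n n 1 k n k≤n) ⟩
      fact n * (ifact k * (segment 1 n ^S k) n)
        -- The vectors of length `n` see only degrees 1 to `n` of `u`. Degree 0 agrees because `u`
        -- has no constant term, and higher degrees do not reach coefficient `n`.
        ≈⟨ *-congˡ (*-congˡ (^S-cong-≤ n k agree n ℕₚ.≤-refl)) ⟩
      fact n * (ifact k * (u ^S k) n)  ∎
      where
      agree : ∀ i → i ≤ n → segment 1 n i ≈ u i
      agree zero    _   = trans (segment-below 1 n 0 (s≤s z≤n)) (sym u0≈0)
      agree (suc i) i<n = segment-inside 1 n (suc i) (s≤s z≤n) (s≤s i<n)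

  -- Reciprocals and quotients of series

  -- Connects `Expands` with a product of series. Since `u ^S n` starts in degree `n`, all inner
  -- sums can be padded with zeros to the common bound `m`, after which the summations may be
  -- exchanged.
  ⋆-∘S : ∀ {u} → u 0 ≈ 0# → ∀ b e m → (b ⋆ (e ∘S u)) m ≈ sum< (suc m) (λ n → e n * (b ⋆ (u ^S n)) m)
  ⋆-∘S {u} u0≈0 b e m = begin
    sum< (suc m) (λ i → b i * sum< (suc (m ∸ i)) (λ n → e n * (u ^S n) (m ∸ i)))
      ≈⟨ sum<-cong′ (suc m) (λ i → *-congˡ (sum<-extend (s≤s (ℕₚ.m∸n≤m m i)) λ n m∸i<n _ →
           trans (*-congˡ (^S-order u0≈0 n (m ∸ i) m∸i<n)) (zeroʳ _))) ⟨
    sum< (suc m) (λ i → b i * sum< (suc m) (λ n → e n * (u ^S n) (m ∸ i)))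
      ≈⟨ sum<-cong′ (suc m) (λ i → *-distribˡ-sum< (suc m) (b i) _) ⟩
    sum< (suc m) (λ i → sum< (suc m) (λ n → b i * (e n * (u ^S n) (m ∸ i))))
      ≈⟨ sum<-swap (suc m) (suc m) _ ⟩
    sum< (suc m) (λ n → sum< (suc m) (λ i → b i * (e n * (u ^S n) (m ∸ i))))
      ≈⟨ sum<-cong′ (suc m) (λ n → sum<-cong′ (suc m) λ i →
           solve 3 (λ a b c → a :* (b :* c) := b :* (a :* c)) refl _ _ _) ⟩
    sum< (suc m) (λ n → sum< (suc m) (λ i → e n * (b i * (u ^S n) (m ∸ i))))
      ≈⟨ sum<-cong′ (suc m) (λ n → *-distribˡ-sum< (suc m) (e n) _) ⟨
    sum< (suc m) (λ n → e n * (b ⋆ (u ^S n)) m)  ∎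

  dropConstant : Series → Series
  dropConstant t zero    = 0#
  dropConstant t (suc i) = t (suc i)

  recipCoeff : Carrier → ℕ → Carrier
  recipCoeff x k = x ⁻¹ * (- (x ⁻¹)) ^ k

  -- The geometric series: with t = t(0) + u, the reciprocal is the sum of (-1)^k t(0)^(-(k+1)) u^k,
  -- whose coefficients are those in `Rhat`.
  recip : Series → Series
  recip t = recipCoeff (t 0) ∘S dropConstant t

  recipCoeff-suc : ∀ x → ¬ (x ≈ 0#) → ∀ k → x * recipCoeff x (suc k) + recipCoeff x k ≈ 0#
  recipCoeff-suc x x≉0 k = begin
    x * (x ⁻¹ * (- (x ⁻¹) * q)) + x ⁻¹ * q
      ≈⟨ +-congʳ (trans (sym (*-assoc _ _ _)) (trans (*-congʳ (⁻¹-inverse x x≉0)) (*-identityˡ _))) ⟩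
    - (x ⁻¹) * q + x ⁻¹ * q   ≈⟨ distribʳ _ _ _ ⟨
    (- (x ⁻¹) + x ⁻¹) * q     ≈⟨ *-congʳ (-‿inverseˡ _) ⟩
    0# * q                    ≈⟨ zeroˡ _ ⟩
    0#                        ∎
    where
    q : Carrier
    q = (- (x ⁻¹)) ^ k

  -- The product telescopes: t(0) times the term of index `suc k` cancels `u` times the term of
  -- index `k`, by `recipCoeff-suc`. The leading 1 survives, and the unpaired last term contains
  -- u^(m+1), which has order above `m`.
  ⋆-recip : ∀ t → ¬ (t 0 ≈ 0#) → (t ⋆ recip t) ≈S oneS
  ⋆-recip t t0≉0 m = begin
    (t ⋆ recip t) m
      ≈⟨ ⋆-cong {t = recip t} split (λ _ → refl) m ⟩
    ((mono 0 (t 0) +S u) ⋆ recip t) m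
      ≈⟨ ⋆-distribʳ (recip t) (mono 0 (t 0)) u m ⟩
    (mono 0 (t 0) ⋆ recip t) m + (u ⋆ recip t) m
      ≈⟨ +-cong (mono-0-⋆ (t 0) (recip t) m) (⋆-∘S refl u e m) ⟩
    t 0 * sum< (suc m) (λ k → e k * (u ^S k) m) + (sum< m (λ k → e k * (u ^S suc k) m) + e m * (u ^S suc m) m)
      ≈⟨ +-cong (*-congˡ (sum<-front m _))
                (trans (+-congˡ (trans (*-congˡ (^S-order refl (suc m) m ℕₚ.≤-refl)) (zeroʳ _))) (+-identityʳ _)) ⟩
    t 0 * (e 0 * oneS m + sum< m (λ k → e (suc k) * (u ^S suc k) m)) + sum< m (λ k → e k * (u ^S suc k) m)
      ≈⟨ solve 5 (λ a b c d f → a :* (b :* c :+ d) :+ f := (a :* b) :* c :+ (a :* d :+ f)) refl _ _ _ _ _ ⟩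
    t 0 * e 0 * oneS m + (t 0 * sum< m (λ k → e (suc k) * (u ^S suc k) m) + sum< m (λ k → e k * (u ^S suc k) m))
      ≈⟨ +-cong (*-congʳ (trans (*-congˡ (*-identityʳ _)) (⁻¹-inverse (t 0) t0≉0)))
                (trans (+-congʳ (*-distribˡ-sum< m (t 0) _)) (sym (sum<-+ m _ _))) ⟩
    1# * oneS m + sum< m (λ k → t 0 * (e (suc k) * (u ^S suc k) m) + e k * (u ^S suc k) m)
      ≈⟨ +-cong (*-identityˡ _) (sum<-zero m λ k _ → begin
           t 0 * (e (suc k) * (u ^S suc k) m) + e k * (u ^S suc k) m
             ≈⟨ solve 4 (λ a b c d → a :* (b :* d) :+ c :* d := (a :* b :+ c) :* d) refl _ _ _ _ ⟩
           (t 0 * e (suc k) + e k) * (u ^S suc k) m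
             ≈⟨ *-congʳ (recipCoeff-suc (t 0) t0≉0 k) ⟩
           0# * (u ^S suc k) m
             ≈⟨ zeroˡ _ ⟩
           0#  ∎) ⟩
    oneS m + 0#
      ≈⟨ +-identityʳ _ ⟩
    oneS m  ∎
    where
    u : Series
    u = dropConstant t
    e : ℕ → Carrier
    e = recipCoeff (t 0)
    split : t ≈S (mono 0 (t 0) +S u)
    split zero    = sym (+-identityʳ _)
    split (suc i) = sym (+-identityˡ _)

  recip-⋆-cancel : ∀ {t g E} → ¬ (t 0 ≈ 0#) → g ≈S (t ⋆ E) → (recip t ⋆ g) ≈S E
  recip-⋆-cancel {t} {g} {E} t0≉0 g≈tE m = begin
    (recip t ⋆ g) m          ≈⟨ ⋆-cong {s = recip t} (λ _ → refl) g≈tE m ⟩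
    (recip t ⋆ (t ⋆ E)) m    ≈⟨ ⋆-assoc (recip t) t E m ⟨
    ((recip t ⋆ t) ⋆ E) m
      ≈⟨ ⋆-cong {t = E} (λ i → trans (⋆-comm (recip t) t i) (⋆-recip t t0≉0 i)) (λ _ → refl) m ⟩
    (oneS ⋆ E) m             ≈⟨ ⋆-identityˡ E m ⟩
    E m                      ∎

  ⋆-recip-cancel : ∀ {t g E} → ¬ (t 0 ≈ 0#) → E ≈S (recip t ⋆ g) → g ≈S (t ⋆ E)
  ⋆-recip-cancel {t} {g} {E} t0≉0 E≈g/t m = sym (begin
    (t ⋆ E) m                ≈⟨ ⋆-cong {s = t} (λ _ → refl) E≈g/t m ⟩
    (t ⋆ (recip t ⋆ g)) m    ≈⟨ ⋆-assoc t (recip t) g m ⟨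
    ((t ⋆ recip t) ⋆ g) m    ≈⟨ ⋆-cong {t = g} (⋆-recip t t0≉0) (λ _ → refl) m ⟩
    (oneS ⋆ g) m             ≈⟨ ⋆-identityˡ g m ⟩
    g m                      ∎)

  -- The k! in `Rhat` cancels the 1/k! of the Bell matrix of `dropConstant t`, leaving the geometric
  -- series term by term.
  Rhat-der : ∀ {t z} → ¬ (t 0 ≈ 0#) → (∀ i → z i ≈ der i t) → ∀ n → Rhat n z ≈ der n (recip t)
  Rhat-der {t} {z} t0≉0 z≈ n = trans
    (sum<-cong (suc n) λ { k (s≤s k≤n) → term k k≤n }) (sym (*-distribˡ-sum< (suc n) (fact n) _))
    where
    u : Series
    u = dropConstant t
    p : Carrier
    p = t 0 ⁻¹
    z0≈t0 : z 0 ≈ t 0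
    z0≈t0 = trans (z≈ 0) (trans (*-congʳ (+-identityʳ 1#)) (*-identityˡ _))
    z0≉0 : ¬ (z 0 ≈ 0#)
    z0≉0 = ≉0-resp (sym z0≈t0) t0≉0
    z≈u : ∀ i → 1 ≤ i → z i ≈ der i u
    z≈u (suc i) _ = z≈ (suc i)
    1^ : ∀ k → 1# ^ k ≈ 1#
    1^ zero    = refl
    1^ (suc k) = trans (*-identityˡ _) (1^ k)
    inv-power : ∀ k → (z 0 ^ k) ⁻¹ ≈ p ^ k
    inv-power k = ⁻¹-unique (^≉0 k z0≉0) (begin
      z 0 ^ k * p ^ k   ≈⟨ *-^ (z 0) p k ⟨
      (z 0 * p) ^ k     ≈⟨ ^-cong k (trans (*-congʳ z0≈t0) (⁻¹-inverse (t 0) t0≉0)) ⟩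
      1# ^ k            ≈⟨ 1^ k ⟩
      1#                ∎)
    term : ∀ k → k ≤ n → (- 1#) ^ k * fact k * (z 0 ^ suc k) ⁻¹ * Bell n k z ≈
                          fact n * (recipCoeff (t 0) k * (u ^S k) n)
    term k k≤n = begin
      (- 1#) ^ k * fact k * (z 0 ^ suc k) ⁻¹ * Bell n k z
        ≈⟨ *-cong (*-congˡ (inv-power (suc k))) (Bell-der u refl z≈u k≤n) ⟩
      (- 1#) ^ k * fact k * (p * p ^ k) * (fact n * (ifact k * (u ^S k) n))
        ≈⟨ solve 7 (λ a b c d e f g → a :* b :* (c :* d) :* (e :* (f :* g)) :=
                                      (b :* f) :* (e :* ((c :* (a :* d)) :* g))) refl _ _ _ _ _ _ _ ⟩
      (fact k * ifact k) * (fact n * (p * ((- 1#) ^ k * p ^ k) * (u ^S k) n))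
        ≈⟨ trans (*-congʳ (fact*ifact k)) (*-identityˡ _) ⟩
      fact n * (p * ((- 1#) ^ k * p ^ k) * (u ^S k) n)
        ≈⟨ *-congˡ (*-congʳ (*-congˡ (trans (sym (*-^ (- 1#) p k)) (^-cong k (-1*x≈-x p))))) ⟩
      fact n * (p * (- p) ^ k * (u ^S k) n)  ∎

  -- Division of a and f by x when a ∈ 𝓕*, so that the quotient f/a is
  -- reduced to a denominator with nonzero constant term for both kinds.
  reduce : Kind → Series → Series
  reduce one  s = s
  reduce star s = λ i → s (suc i)

  reduce≉0 : ∀ k {a} → InKind k a → ¬ (reduce k a 0 ≈ 0#)
  reduce≉0 one  a0≉0             = a0≉0
  reduce≉0 star (_ , a′0≉0) a1≈0 = a′0≉0 (trans (*-congˡ a1≈0) (zeroʳ _))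

  ⋆-suc : ∀ {a} E → a 0 ≈ 0# → ∀ m → (a ⋆ E) (suc m) ≈ (reduce star a ⋆ E) m
  ⋆-suc E a0≈0 m =
    trans (sum<-front (suc m) _) (trans (+-congʳ (trans (*-congʳ a0≈0) (zeroˡ _))) (+-identityˡ _))

  reduce-⋆ : ∀ k {f a E} → InKind k a → f ≈S (a ⋆ E) → reduce k f ≈S (reduce k a ⋆ E)
  reduce-⋆ one  _              f≈aE   = f≈aE
  reduce-⋆ star {E = E} (a0≈0 , _) f≈aE m = trans (f≈aE (suc m)) (⋆-suc E a0≈0 m)

  -- Division by x forgets the equation in degree 0. For `star` it is restored by the vanishing of
  -- both `f` and `a` at 0.
  reduce-⋆⁻¹ : ∀ k {f a E} → f 0 ≈ 0# → InKind k a → reduce k f ≈S (reduce k a ⋆ E) → f ≈S (a ⋆ E)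
  reduce-⋆⁻¹ one  _ _ eq = eq
  reduce-⋆⁻¹ star {E = E} f0≈0 (a0≈0 , _) eq zero    =
    trans f0≈0 (sym (trans (+-identityˡ _) (trans (*-congʳ a0≈0) (zeroˡ _))))
  reduce-⋆⁻¹ star {E = E} f0≈0 (a0≈0 , _) eq (suc m) = trans (eq m) (sym (⋆-suc E a0≈0 m))

  quotient : Kind → Series → Series → Series
  quotient k f a = recip (reduce k a) ⋆ reduce k f

  egf : (ℕ → Carrier) → Series
  egf cs n = cs n * ifact n

  module _ {f a φ : Series} {k : Kind} (φ0≈0 : φ 0 ≈ 0#) (a∈ : InKind k a) {cs : ℕ → Carrier} where

    Expands⇒quotient : Expands f a φ cs → quotient k f a ≈S (egf cs ∘S φ)
    Expands⇒quotient ex = recip-⋆-cancel {E = egf cs ∘S φ} (reduce≉0 k a∈)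
      (reduce-⋆ k {E = egf cs ∘S φ} a∈ λ m → trans (ex m) (sym (⋆-∘S φ0≈0 a (egf cs) m)))

    quotient⇒Expands : f 0 ≈ 0# → (egf cs ∘S φ) ≈S quotient k f a → Expands f a φ cs
    quotient⇒Expands f0≈0 eq m = trans
      (reduce-⋆⁻¹ k {E = egf cs ∘S φ} f0≈0 a∈ (⋆-recip-cancel {E = egf cs ∘S φ} (reduce≉0 k a∈) eq) m) (⋆-∘S φ0≈0 a (egf cs) m)

  -- Evaluation of Γ

  -- The Leibniz rule for the `n`-th derivative at 0 of a φ^k/k!. The derivatives of φ^k of order
  -- below `k` vanish, which accounts for the truncation at `k`.
  Γ-coeff : ∀ {φ} → φ 0 ≈ 0# → ∀ a n k →
    sumFromTo k n (λ j → natK (n C j) * der (n ∸ j) a * Bell j k (λ i → der i φ)) ≈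
    fact n * (ifact k * (a ⋆ (φ ^S k)) n)
  Γ-coeff {φ} φ0≈0 a n k = begin
    sumFromTo k n (λ j → natK (n C j) * der (n ∸ j) a * Bell j k (λ i → der i φ))
      ≈⟨ sumFromTo-extend k n term (λ j j<k →
           trans (*-congˡ (*-congˡ (trans (*-congʳ (^S-order φ0≈0 k j j<k)) (zeroˡ _))))
                 (trans (*-congˡ (zeroʳ _)) (zeroʳ _))) ⟩
    sum< (suc n) (λ j → fact n * (ifact k * ((φ ^S k) j * a (n ∸ j))))
      ≈⟨ *-distribˡ-sum< (suc n) (fact n) _ ⟨
    fact n * sum< (suc n) (λ j → ifact k * ((φ ^S k) j * a (n ∸ j)))
      ≈⟨ *-congˡ (*-distribˡ-sum< (suc n) (ifact k) _) ⟨
    fact n * (ifact k * ((φ ^S k) ⋆ a) n)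
      ≈⟨ *-congˡ (*-congˡ (⋆-comm (φ ^S k) a n)) ⟩
    fact n * (ifact k * (a ⋆ (φ ^S k)) n)  ∎
    where
    term : ∀ j → k ≤ j → j ≤ n → natK (n C j) * der (n ∸ j) a * Bell j k (λ i → der i φ) ≈
                                  fact n * (ifact k * ((φ ^S k) j * a (n ∸ j)))
    term j k≤j j≤n = begin
      natK (n C j) * (fact (n ∸ j) * a (n ∸ j)) * Bell j k (λ i → der i φ)
        ≈⟨ *-congˡ (Bell-der φ φ0≈0 (λ _ _ → refl) k≤j) ⟩
      natK (n C j) * (fact (n ∸ j) * a (n ∸ j)) * (fact j * (ifact k * (φ ^S k) j))
        ≈⟨ solve 6 (λ a b c d e f → a :* (b :* c) :* (d :* (e :* f)) :=
                                    (a :* (d :* b)) :* (e :* (f :* c))) refl _ _ _ _ _ _ ⟩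
      natK (n C j) * (fact j * fact (n ∸ j)) * (ifact k * ((φ ^S k) j * a (n ∸ j)))
        ≈⟨ *-congʳ (fact-C j≤n) ⟩
      fact n * (ifact k * ((φ ^S k) j * a (n ∸ j)))  ∎

  -- Justifies the substitution of 0 for `X_0` in the first version of `Γ`: in degree 0 the
  -- expansion reads f(0) = c_0 a(0).
  Expands-constant : ∀ {f a φ cs} → f 0 ≈ 0# → F₁ a → Expands f a φ cs → cs 0 ≈ 0#
  Expands-constant {f} {a} {φ} {cs} f0≈0 a0≉0 ex = *-cancelˡ (ifact 0 * a 0) (*≉0 ifact0≉0 a0≉0) (begin
    ifact 0 * a 0 * cs 0                           ≈⟨ solve 3 (λ i a c → i :* a :* c := c :* i :* a) refl _ _ _ ⟩
    cs 0 * ifact 0 * a 0                           ≈⟨ *-congˡ (trans (+-identityˡ _) (*-identityʳ _)) ⟨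
    cs 0 * ifact 0 * (a ⋆ (φ ^S 0)) 0              ≈⟨ +-identityˡ _ ⟨
    0# + cs 0 * ifact 0 * (a ⋆ (φ ^S 0)) 0         ≈⟨ ex 0 ⟨
    f 0                                            ≈⟨ f0≈0 ⟩
    0#                                             ≈⟨ zeroʳ _ ⟨
    ifact 0 * a 0 * 0#                             ∎)
    where
    ifact0≉0 : ¬ (ifact 0 ≈ 0#)
    ifact0≉0 i≈0 = 1≉0 (trans (sym (fact*ifact 0)) (trans (*-congˡ i≈0) (zeroʳ _)))

  Γ-der : ∀ k {f a φ cs} → f 0 ≈ 0# → φ 0 ≈ 0# → InKind k a → Expands f a φ cs →
          ∀ n → Γ k a φ n cs ≈ der n f
  Γ-der k {f} {a} {φ} {cs} f0≈0 φ0≈0 a∈ ex n = trans (argument k a∈) (begin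
    sum< (suc n) (λ i → fact n * (ifact i * (a ⋆ (φ ^S i)) n) * cs i)
      ≈⟨ sum<-cong′ (suc n) (λ i → solve 4 (λ a b c d → a :* (b :* c) :* d := a :* (d :* b :* c)) refl _ _ _ _) ⟩
    sum< (suc n) (λ i → fact n * (cs i * ifact i * (a ⋆ (φ ^S i)) n))
      ≈⟨ *-distribˡ-sum< (suc n) (fact n) _ ⟨
    fact n * sum< (suc n) (λ i → cs i * ifact i * (a ⋆ (φ ^S i)) n)
      ≈⟨ *-congˡ (ex n) ⟨
    der n f  ∎)
    where
    argument : ∀ k → InKind k a →
      Γ k a φ n cs ≈ sum< (suc n) (λ i → fact n * (ifact i * (a ⋆ (φ ^S i)) n) * cs i)
    argument one  a0≉0 = sum<-cong′ (suc n) λ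
      { zero    → *-cong (Γ-coeff φ0≈0 a n 0) (sym (Expands-constant f0≈0 a0≉0 ex))
      ; (suc i) → *-congʳ (Γ-coeff φ0≈0 a n (suc i)) }
    argument star _    = sum<-cong′ (suc n) λ i → *-congʳ (Γ-coeff φ0≈0 a n i)

  -- Inverting the Bell matrix

  sum<-- : ∀ n f g → sum< n (λ i → f i - g i) ≈ sum< n f - sum< n g
  sum<-- n f g = begin
    sum< n (λ i → f i - g i)              ≈⟨ sum<-+ n f _ ⟩
    sum< n f + sum< n (λ i → - g i)       ≈⟨ +-congˡ (sum<-cong′ n λ i → -1*x≈-x (g i)) ⟨
    sum< n f + sum< n (λ i → - 1# * g i)  ≈⟨ +-congˡ (*-distribˡ-sum< n (- 1#) g) ⟨
    sum< n f + - 1# * sum< n g            ≈⟨ +-congˡ (-1*x≈-x _) ⟩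
    sum< n f - sum< n g                   ∎

  -- The point `x` is kept apart from the derivatives of `u`, so that `x` can later be the sequence
  -- of values of `Γ` itself.
  module BellInverse
    (A : ℕ → ℕ → (ℕ → Carrier) → Carrier) (isA : IsAFamily A)
    {u : Series} (u∈F* : F* u) {x : ℕ → Carrier} (x≈ : ∀ i → 1 ≤ i → x i ≈ der i u) where

    private
      u0≈0 : u 0 ≈ 0#
      u0≈0 = proj₁ u∈F*
      x1≉0 : ¬ (x 1 ≈ 0#)
      x1≉0 = ≉0-resp (sym (x≈ 1 ℕₚ.≤-refl)) (proj₂ u∈F*)

    -- The Bell matrix in closed form. It vanishes above the diagonal, so sums against it can be
    -- padded to a common bound.
    bell : ℕ → ℕ → Carrier
    bell j k = fact j * (ifact k * (u ^S k) j)

    bell-upper : ∀ j k → j < k → bell j k ≈ 0#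
    bell-upper j k j<k =
      trans (*-congˡ (trans (*-congˡ (^S-order u0≈0 k j j<k)) (zeroʳ _))) (zeroʳ _)

    bell-egf : ∀ m w → sum< (suc m) (λ k → bell m k * w k) ≈ fact m * (egf w ∘S u) m
    bell-egf m w = trans
      (sum<-cong′ (suc m) λ k → solve 4 (λ a b c d → a :* (b :* c) :* d := a :* (d :* b :* c)) refl _ _ _ _)
      (sym (*-distribˡ-sum< (suc m) (fact m) _))

    -- δ n k is definitionally mono n 1# k.
    A-bell : ∀ n k → sum< (suc n) (λ j → A n j x * bell j k) ≈ δ n k
    A-bell n k with k ℕₚ.≤? n
    ... | yes k≤n = trans
      (sym (sumFromTo-extend k n (λ j k≤j _ → *-congˡ (Bell-der u u0≈0 x≈ k≤j))
                                 (λ j j<k → trans (*-congˡ (bell-upper j k j<k)) (zeroʳ _))))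
      (proj₂ (proj₂ (proj₂ (isA x x1≉0))) n k k≤n)
    ... | no k≰n = trans
      (sum<-zero (suc n) λ { j (s≤s j≤n) →
        trans (*-congˡ (bell-upper j k (ℕₚ.≤-<-trans j≤n (ℕₚ.≰⇒> k≰n)))) (zeroʳ _) })
      (sym (mono-off n 1# k (ℕₚ.<⇒≢ (ℕₚ.≰⇒> k≰n))))

    applyA : (ℕ → Carrier) → ℕ → Carrier
    applyA v n = sum< (suc n) (λ j → A n j x * v j)

    A-solve : ∀ {v w : ℕ → Carrier} → (∀ j → v j ≈ sum< (suc j) (λ k → bell j k * w k)) → ∀ n → applyA v n ≈ w n
    A-solve {v} {w} v≈ n = begin
      sum< (suc n) (λ j → A n j x * v j)
        ≈⟨ sum<-cong (suc n) (λ { j (s≤s j≤n) → *-congˡ (trans (v≈ j)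
             (sym (sum<-extend (s≤s j≤n) λ k j<k _ → trans (*-congʳ (bell-upper j k j<k)) (zeroˡ _)))) }) ⟩
      sum< (suc n) (λ j → A n j x * sum< (suc n) (λ k → bell j k * w k))
        ≈⟨ sum<-cong′ (suc n) (λ j → trans (*-distribˡ-sum< (suc n) _ _)
             (sum<-cong′ (suc n) λ k → sym (*-assoc _ _ _))) ⟩
      sum< (suc n) (λ j → sum< (suc n) (λ k → A n j x * bell j k * w k))
        ≈⟨ sum<-swap (suc n) (suc n) _ ⟩
      sum< (suc n) (λ k → sum< (suc n) (λ j → A n j x * bell j k * w k))
        ≈⟨ sum<-cong′ (suc n) (λ k → trans (sym (*-distribʳ-sum< (suc n) (w k) _)) (*-congʳ (A-bell n k))) ⟩
      sum< (suc n) (λ k → δ n k * w k)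
        ≈⟨ sum<-single ℕₚ.≤-refl (λ k _ k≢n →
             trans (*-congʳ (mono-off n 1# k (λ n≡k → k≢n (≡.sym n≡k)))) (zeroˡ _)) ⟩
      δ n n * w n
        ≈⟨ trans (*-congʳ (mono-diag n 1#)) (*-identityˡ _) ⟩
      w n  ∎

    A-diag : ∀ n → A n n x * bell n n ≈ 1#
    A-diag n = begin
      A n n x * bell n n
        ≈⟨ sum<-single ℕₚ.≤-refl (λ { j (s≤s j≤n) j≢n →
             trans (*-congˡ (bell-upper j n (ℕₚ.≤∧≢⇒< j≤n j≢n))) (zeroʳ _) }) ⟨
      sum< (suc n) (λ j → A n j x * bell j n)   ≈⟨ A-bell n n ⟩
      δ n n                                     ≈⟨ mono-diag n 1# ⟩
      1#                                        ∎

    -- Forward substitution: once `e` vanishes below `n`, only the diagonal term of `applyA e n` is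
    -- left, and `A-diag` exhibits `bell n n` as the inverse of its coefficient.
    A-injective : ∀ {e : ℕ → Carrier} → (∀ n → applyA e n ≈ 0#) → ∀ n → e n ≈ 0#
    A-injective {e} Ae≈0 = <-rec _ λ n e<n≈0 → begin
      e n                            ≈⟨ *-identityˡ _ ⟨
      1# * e n                       ≈⟨ *-congʳ (A-diag n) ⟨
      A n n x * bell n n * e n       ≈⟨ solve 3 (λ a b c → a :* b :* c := b :* (a :* c)) refl _ _ _ ⟩
      bell n n * (A n n x * e n)     ≈⟨ *-congˡ (+-identityˡ _) ⟨
      bell n n * (0# + A n n x * e n)
        ≈⟨ *-congˡ (+-congʳ (sum<-zero n λ j j<n → trans (*-congˡ (e<n≈0 j<n)) (zeroʳ _))) ⟨
      bell n n * applyA e n          ≈⟨ *-congˡ (Ae≈0 n) ⟩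
      bell n n * 0#                  ≈⟨ zeroʳ _ ⟩
      0#                             ∎

    -- The defining system says A B = 1, whereas existence of an expansion requires B A = 1. Now A
    -- (B A H - H) = A H - A H = 0, and `A` is injective.
    A-section : ∀ H m → sum< (suc m) (λ k → bell m k * applyA H k) ≈ H m
    A-section H m = x∙y⁻¹≈ε⇒x≈y _ _ (A-injective A[v-H]≈0 m)
      where
      v : ℕ → Carrier
      v m = sum< (suc m) (λ k → bell m k * applyA H k)
      A[v-H]≈0 : ∀ n → applyA (λ j → v j - H j) n ≈ 0#
      A[v-H]≈0 n = begin
        applyA (λ j → v j - H j) n    ≈⟨ sum<-cong′ (suc n) (λ j → x[y-z]≈xy-xz (A n j x) (v j) (H j)) ⟩
        sum< (suc n) (λ j → A n j x * v j - A n j x * H j)  ≈⟨ sum<-- (suc n) _ _ ⟩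
        applyA v n - applyA H n       ≈⟨ +-congʳ (A-solve (λ _ → refl) n) ⟩
        applyA H n - applyA H n       ≈⟨ -‿inverseʳ _ ⟩
        0#                            ∎

    A-compInverse : ∀ {g} → (g ∘S u) ≈S Xs → ∀ n → A n 1 x ≈ der n g
    A-compInverse {g} g∘u≈X n = trans (sym (column n)) (A-solve {λ j → δ j 1} (λ j → sym (begin
      sum< (suc j) (λ k → bell j k * der k g)   ≈⟨ bell-egf j (λ k → der k g) ⟩
      fact j * (egf (λ k → der k g) ∘S u) j
        ≈⟨ *-congˡ (sum<-cong′ (suc j) λ k → *-congʳ (trans
             (solve 3 (λ a b c → a :* b :* c := (a :* c) :* b) refl _ _ _)
             (trans (*-congʳ (fact*ifact k)) (*-identityˡ _)))) ⟩
      fact j * (g ∘S u) j                       ≈⟨ *-congˡ (g∘u≈X j) ⟩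
      fact j * Xs j                             ≈⟨ fact-Xs j ⟩
      δ j 1                                     ∎)) n)
      where
      fact-Xs : ∀ j → fact j * Xs j ≈ Xs j
      fact-Xs zero          = zeroʳ _
      fact-Xs (suc zero)    = trans (*-identityʳ _) (+-identityʳ 1#)
      fact-Xs (suc (suc j)) = zeroʳ _
      column : ∀ n → applyA (λ j → δ j 1) n ≈ A n 1 x
      -- For `n = 0` the sum does not reach the index 1; its value 0 matches `A 0 1`, which lies
      -- above the diagonal.
      column zero    = trans (+-identityˡ _)
        (trans (zeroʳ _) (sym (proj₁ (proj₂ (proj₂ (isA x x1≉0))) 0 1 (s≤s z≤n))))
      column (suc n) = trans
        (sum<-single {suc (suc n)} (s≤s (s≤s z≤n)) λ j _ j≢1 → trans (*-congˡ (mono-off j 1# 1 j≢1)) (zeroʳ _))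
        (*-identityʳ _)

  -- The expansion coefficients

  module Coefficients
    (A : ℕ → ℕ → (ℕ → Carrier) → Carrier) (isA : IsAFamily A) where

    coefficients : Series → Kind → Series → Series → ℕ → Carrier
    coefficients f k a φ n =
      sum< (suc n) (λ j → A n j (λ i → der i φ) * der j (quotient k f a))

    module _ {f φ a : Series} {k : Kind} (f0≈0 : f 0 ≈ 0#) (φ∈F* : F* φ) (a∈ : InKind k a) where
      open BellInverse A isA φ∈F* {λ i → der i φ} (λ _ _ → refl)

      coefficients-unique : ∀ {cs} → Expands f a φ cs → ∀ n → cs n ≈ coefficients f k a φ n
      coefficients-unique {cs} ex n = sym (A-solve (λ j → trans
        (*-congˡ (Expands⇒quotient {k = k} (proj₁ φ∈F*) a∈ ex j)) (sym (bell-egf j cs))) n)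

      coefficients-expand : Expands f a φ (coefficients f k a φ)
      coefficients-expand = quotient⇒Expands {k = k} (proj₁ φ∈F*) a∈ f0≈0 λ m →
        *-cancelˡ (fact m) (fact≉0 m)
          (trans (sym (bell-egf m (coefficients f k a φ))) (A-section (λ j → der j (quotient k f a)) m))

    -- For fixed `j`, the sum over `k` is the Leibniz rule for the `j`-th derivative of g/t. The
    -- sequence `α` stands for a row of `A`, and `t` is left general because it is `b` in one
    -- version of `Γbar` and b/x in the other.
    reciprocalSum : ∀ {t z} → ¬ (t 0 ≈ 0#) → (∀ i → z i ≈ der i t) →
      ∀ {g : Series} {y : ℕ → Carrier} → (∀ k → y k ≈ der k g) → ∀ n (α : ℕ → Carrier) →
      sum< (suc n) (λ k → sumFromTo k n (λ j → natK (j C k) * Rhat (j ∸ k) z * α j) * y k) ≈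
      sum< (suc n) (λ j → α j * der j (recip t ⋆ g))
    reciprocalSum {t} {z} t0≉0 z≈ {g} {y} y≈ n α = begin
      sum< (suc n) (λ k → sumFromTo k n (λ j → γ j k) * y k)
        ≈⟨ sum<-cong′ (suc n) (λ k → trans
             (*-congʳ (sumFromTo-extend k n (λ _ _ _ → refl) (λ j j<k → γ-upper j k j<k)))
             (*-distribʳ-sum< (suc n) (y k) _)) ⟩
      sum< (suc n) (λ k → sum< (suc n) (λ j → γ j k * y k))
        ≈⟨ sum<-swap (suc n) (suc n) _ ⟩
      sum< (suc n) (λ j → sum< (suc n) (λ k → γ j k * y k))
        ≈⟨ sum<-cong (suc n) (λ { j (s≤s j≤n) →
             sum<-extend (s≤s j≤n) λ k j<k _ → trans (*-congʳ (γ-upper j k j<k)) (zeroˡ _) }) ⟩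
      sum< (suc n) (λ j → sum< (suc j) (λ k → γ j k * y k))
        ≈⟨ sum<-cong′ (suc n) (λ j → begin
             sum< (suc j) (λ k → γ j k * y k)
               ≈⟨ sum<-cong (suc j) (λ { k (s≤s k≤j) → term j k k≤j }) ⟩
             sum< (suc j) (λ k → α j * (fact j * (g k * recip t (j ∸ k))))
               ≈⟨ *-distribˡ-sum< (suc j) (α j) _ ⟨
             α j * sum< (suc j) (λ k → fact j * (g k * recip t (j ∸ k)))
               ≈⟨ *-congˡ (*-distribˡ-sum< (suc j) (fact j) _) ⟨
             α j * (fact j * (g ⋆ recip t) j)
               ≈⟨ *-congˡ (*-congˡ (⋆-comm g (recip t) j)) ⟩
             α j * der j (recip t ⋆ g)  ∎) ⟩
      sum< (suc n) (λ j → α j * der j (recip t ⋆ g))  ∎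
      where
      γ : ℕ → ℕ → Carrier
      γ j k = natK (j C k) * Rhat (j ∸ k) z * α j
      γ-upper : ∀ j k → j < k → γ j k ≈ 0#
      γ-upper j k j<k = trans
        (*-congʳ (trans (*-congʳ (reflexive (≡.cong natK (k>n⇒nCk≡0 j<k)))) (zeroˡ _))) (zeroˡ _)
      term : ∀ j k → k ≤ j → γ j k * y k ≈ α j * (fact j * (g k * recip t (j ∸ k)))
      term j k k≤j = begin
        natK (j C k) * Rhat (j ∸ k) z * α j * y k
          ≈⟨ *-cong (*-congʳ (*-congˡ (Rhat-der t0≉0 z≈ (j ∸ k)))) (y≈ k) ⟩
        natK (j C k) * (fact (j ∸ k) * recip t (j ∸ k)) * α j * (fact k * g k)
          ≈⟨ solve 6 (λ a b c d e f → a :* (b :* c) :* d :* (e :* f) :=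
                                      d :* ((a :* (e :* b)) :* (f :* c))) refl _ _ _ _ _ _ ⟩
        α j * (natK (j C k) * (fact k * fact (j ∸ k)) * (g k * recip t (j ∸ k)))
          ≈⟨ *-congˡ (*-congʳ (fact-C k≤j)) ⟩
        α j * (fact j * (g k * recip t (j ∸ k)))  ∎

    -- Accounts for both occurrences of 1/(k+1) in the second version of `Γbar`: the arguments of
    -- `Rhat` are the derivatives of b/x, and the outer factor times `y (suc k)` is a derivative of
    -- f/x.
    der-reduce : ∀ s i → natK (suc i) ⁻¹ * der (suc i) s ≈ der i (reduce star s)
    der-reduce s i = begin
      natK (suc i) ⁻¹ * (natK (suc i ℕ.* i !) * s (suc i))
        ≈⟨ *-congˡ (*-congʳ (natK-* (suc i) (i !))) ⟩
      natK (suc i) ⁻¹ * (natK (suc i) * fact i * s (suc i))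
        ≈⟨ solve 4 (λ a b c d → a :* (b :* c :* d) := (b :* a) :* (c :* d)) refl _ _ _ _ ⟩
      natK (suc i) * natK (suc i) ⁻¹ * (fact i * s (suc i))
        ≈⟨ trans (*-congʳ (⁻¹-inverse (natK (suc i)) (charZero i))) (*-identityˡ _) ⟩
      fact i * s (suc i)  ∎

    Γbar-coefficients : ∀ k {f b ψ y} → InKind k b → (∀ i → y i ≈ der i f) →
      ∀ n → Γbar A k b ψ n y ≈ coefficients f k b ψ n
    Γbar-coefficients one  b∈ y≈ n = reciprocalSum b∈ (λ _ → refl) y≈ n _
    Γbar-coefficients star {f} {b} {ψ} {y} b∈ y≈ n = trans
      (sum<-cong′ (suc n) λ k → solve 3 (λ i s y → i :* s :* y := s :* (i :* y)) refl _ _ _)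
      (reciprocalSum (reduce≉0 star {b} b∈) (der-reduce b)
        (λ k → trans (*-congˡ (y≈ (suc k))) (der-reduce f k)) n _)

    Λ-coefficients : ∀ {f g a b φ ψ ka kb cs} → F* f → F* φ → InKind ka a → InKind kb b →
      (g ∘S f) ≈S Xs → Expands f a φ cs → ∀ n → Λ A ka a φ kb b ψ n cs ≈ coefficients g kb b ψ n
    Λ-coefficients {ka = ka} {kb} f∈F* φ∈F* a∈ b∈ g∘f≈X ex = Γbar-coefficients kb b∈
      -- Here `x` is the sequence of the `Γ ka a φ i cs`, and `Γ-der` supplies its agreement with
      -- the derivatives of `f`.
      (BellInverse.A-compInverse A isA f∈F* (λ i _ → Γ-der ka (proj₁ f∈F*) (proj₁ φ∈F*) a∈ ex i) g∘f≈X)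

  -- In degree 1 the identity f(g(x)) = x reads f_1 g_1 = 1, so g_1 cannot vanish.
  compInverse-F* : ∀ {f g} → IsCompInverse f g → F* g
  compInverse-F* {f} {g} (g0≈0 , f∘g≈X , _) = g0≈0 , λ g′0≈0 → 1≉0 (begin
    1#                                            ≈⟨ f∘g≈X 1 ⟨
    0# + f 0 * 0# + f 1 * (g ⋆ oneS) 1
      ≈⟨ +-cong (trans (+-identityˡ _) (zeroʳ _))
                (*-congˡ (trans (⋆-comm g oneS 1) (trans (⋆-identityˡ g 1) (g1≈0 g′0≈0)))) ⟩
    0# + f 1 * 0#                                 ≈⟨ trans (+-identityˡ _) (zeroʳ _) ⟩
    0#                                            ∎)
    where
    g1≈0 : der 1 g ≈ 0# → g 1 ≈ 0#
    g1≈0 g′0≈0 = trans (sym (trans (*-congʳ (+-identityʳ 1#)) (*-identityˡ _))) g′0≈0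

theorem7p9 : ∀ {c ℓ : Level} (F : CharZeroField c ℓ) →
    let open CharZeroField F in
    let open FPS F in
    (A : ℕ → ℕ → (ℕ → Carrier) → Carrier) → IsAFamily A →
    (f φ ψ : Series) → F* f → F* φ → F* ψ →
    (ka kb : Kind) (a b : Series) → InKind ka a → InKind kb b →
    (fbar : Series) → IsCompInverse f fbar →
    (Σ[ cs ∈ (ℕ → Carrier) ] (Expands f a φ cs
    × (∀ cs′ → Expands f a φ cs′ → ∀ n → cs′ n ≈ cs n)))
    × (Σ[ ds ∈ (ℕ → Carrier) ] (Expands fbar b ψ ds
    × (∀ ds′ → Expands fbar b ψ ds′ → ∀ n → ds′ n ≈ ds n)))
    × (∀ cs ds → Expands f a φ cs → Expands fbar b ψ ds →
    (∀ n → ds n ≈ Λ A ka a φ kb b ψ n cs)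
    × (∀ n → cs n ≈ Λ A kb b ψ ka a φ n ds))
theorem7p9 F A isA f φ ψ f∈ φ∈ ψ∈ ka kb a b a∈ b∈ fbar inverse@(fbar0≈0 , f∘fbar≈X , fbar∘f≈X) =
    (coefficients f ka a φ , coefficients-expand (proj₁ f∈) φ∈ a∈ , λ cs → unique-c)
  , (coefficients fbar kb b ψ , coefficients-expand fbar0≈0 ψ∈ b∈ , λ ds → unique-d)
  , λ cs ds ex-c ex-d →
      (λ n → trans (unique-d ex-d n) (sym (Λ-coefficients f∈ φ∈ a∈ b∈ fbar∘f≈X ex-c n)))
    -- The roles of `f` and `fbar` are exchanged; accordingly the other composite, `f∘fbar≈X`,
    -- enters.
    , (λ n → trans (unique-c ex-c n)
        (sym (Λ-coefficients (compInverse-F* inverse) ψ∈ b∈ a∈ f∘fbar≈X ex-d n)))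
  where
  open CharZeroField F using (_≈_; sym; trans)
  open FPS F using (Expands)
  open Expansion F
  open Coefficients A isA
  unique-c : ∀ {cs} → Expands f a φ cs → ∀ n → cs n ≈ coefficients f ka a φ n
  unique-c = coefficients-unique (proj₁ f∈) φ∈ a∈
  unique-d : ∀ {ds} → Expands fbar b ψ ds → ∀ n → ds n ≈ coefficients fbar kb b ψ n
  unique-d = coefficients-unique fbar0≈0 ψ∈ b∈
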